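{- Let $p\ge 5$ be a prime and let $t$ be the smallest prime divisor of $(p-1)/2$. Then the maximal cross-correlation $C(\mathcal{W}_p)$ of the family $\mathcal{W}_p$ of Welch Costas permutations of $\{1,\ldots,p-1\}$ satisfies $$C(\mathcal{W}_p)\le 1+\left\lfloor\left(1-\frac{2}{p-1}\right)p^{1/2}\right\rfloor \quad\text{if $p$ is a safe prime},$$ and $$C(\mathcal{W}_p)=\frac{p-1}{t}\quad\text{otherwise}.$$
   Context: For a positive integer $n$ and two maps $f_1,f_2:\{1,\ldots,n\}\to\{1,\ldots,n\}$, the cross-correlation $C_{f_1,f_2}(u,v)$ at $(u,v)\in\mathbb{Z}^2$ with $1-n\le u,v\le n-1$ is the number of integers $x\in\{\max\{1,1-u\},\ldots,\min\{n,n-u\}\}$ with $f_1(x)+v=f_2(x+u)$. For a family $\mathcal{F}$ of permutations of $\{1,\ldots,n\}$, the maximal cross-correlation is $C(\mathcal{F})=\max_{u,v}\max_{f_1,f_2\in\mathcal{F},\,f_1\ne f_2}C_{f_1,f_2}(u,v)$, the outer maximum over $1-n\le u,v\le n-1$. For a prime $p$ and a primitive root $g$ modulo $p$, $\pi_g$ is the permutation of $\{1,\ldots,p-1\}$ with $\pi_g(i)\equiv g^i \bmod p$. The Welch family is $\mathcal{W}_p=\{\pi_g: g \text{ a primitive root modulo } p\}$ (a family of permutations of $\{1,\ldots,p-1\}$, so $n=p-1$). A prime $p$ is a safe prime if $(p-1)/2$ is also prime. -}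

module Defs where

open import Data.Nat as ℕ using (ℕ; zero; suc; _+_; _*_; _∸_; _^_; _⊔_; NonZero)
open import Data.Nat.DivMod using (_%_)
open import Data.Integer as ℤ using (ℤ; +_; _-_; ∣_∣)
open import Data.List using (List; map; upTo; filter; length; foldr; concatMap; cartesianProduct)
open import Data.List.Relation.Unary.All using (All; all?)
open import Data.Product using (_×_; _,_)
open import Relation.Nullary using (¬_; Dec; yes; no; ¬?; _×-dec_)
open import Relation.Binary.PropositionalEquality using (_≡_; _≢_)

rangeℕ : ℕ → ℕ → List ℕ
rangeℕ a b = map (λ i → a + i) (upTo (suc b ∸ a))

shifts : ℕ → List ℤ
shifts n = map (λ k → + k - + (n ∸ 1)) (upTo ((n + n) ∸ 1))

-- Cross-correlation C_{f1,f2}(u,v) of two maps {1..n} → {1..n}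
-- (represented as functions ℕ → ℕ; only values on 1..n matter).
-- x ranges over max{1,1-u}..min{n,n-u}, i.e. over those x ∈ 1..n with
-- 1 ≤ x + u ≤ n; counted are those with f1(x) + v = f2(x + u).
crossCorrelation : ℕ → (ℕ → ℕ) → (ℕ → ℕ) → ℤ → ℤ → ℕ
crossCorrelation n f₁ f₂ u v = length (filter P? (rangeℕ 1 n))
  where
  P? : (x : ℕ) → Dec ((+ 1 ℤ.≤ + x ℤ.+ u × + x ℤ.+ u ℤ.≤ + n)
                      × + f₁ x ℤ.+ v ≡ + f₂ ∣ + x ℤ.+ u ∣)
  P? x = ((+ 1 ℤ.≤? + x ℤ.+ u) ×-dec (+ x ℤ.+ u ℤ.≤? + n))
         ×-dec (+ f₁ x ℤ.+ v ℤ.≟ + f₂ ∣ + x ℤ.+ u ∣)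

-- g (with 1 ≤ g ≤ p-1) is a primitive root modulo p:
-- g^k mod p ≠ 1 for every 1 ≤ k ≤ p-2, i.e. g has multiplicative order p-1.
IsPrimitiveRoot : (p : ℕ) .{{_ : NonZero p}} → ℕ → Set
IsPrimitiveRoot p g = All (λ k → g ^ k % p ≢ 1) (rangeℕ 1 (p ∸ 2))

isPrimitiveRoot? : (p : ℕ) .{{_ : NonZero p}} → (g : ℕ) → Dec (IsPrimitiveRoot p g)
isPrimitiveRoot? p g = all? (λ k → ¬? (g ^ k % p ℕ.≟ 1)) (rangeℕ 1 (p ∸ 2))

primitiveRoots : (p : ℕ) .{{_ : NonZero p}} → List ℕ
primitiveRoots p = filter (isPrimitiveRoot? p) (rangeℕ 1 (p ∸ 1))

welchPerm : (p : ℕ) .{{_ : NonZero p}} → ℕ → ℕ → ℕ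
welchPerm p g i = g ^ i % p

maxList : List ℕ → ℕ
maxList = foldr _⊔_ 0

-- C(W_p): maximum of C_{π_g1,π_g2}(u,v) over distinct primitive roots
-- g1 ≠ g2 in {1..p-1} (equivalently π_g1 ≠ π_g2, since π_g(1) = g)
-- and over 1-n ≤ u, v ≤ n-1 with n = p-1.
maxCrossCorrelationWelch : (p : ℕ) .{{_ : NonZero p}} → ℕ
maxCrossCorrelationWelch p =
  maxList (concatMap values
    (filter (λ { (g₁ , g₂) → ¬? (g₁ ℕ.≟ g₂) })
            (cartesianProduct (primitiveRoots p) (primitiveRoots p))))
  where
  n = p ∸ 1
  values : ℕ × ℕ → List ℕ
  values (g₁ , g₂) =
    concatMap (λ u → map (λ v → crossCorrelation n (welchPerm p g₁) (welchPerm p g₂) u v)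
                         (shifts n))
              (shifts n)

welchFloorSearch : ℕ → ℕ → ℕ
welchFloorSearch p zero = zero
welchFloorSearch p (suc k) with (suc k * (p ∸ 1)) ^ 2 ℕ.≤? (p ∸ 3) ^ 2 * p
... | yes _ = suc k
... | no _ = welchFloorSearch p k

-- ⌊(1 - 2/(p-1)) √p⌋ for p ≥ 5: the largest natural k with
-- k ≤ (p-3)/(p-1) · √p, i.e. (k(p-1))^2 ≤ (p-3)^2 p; it is ≤ p, so a
-- search over 0..p suffices.
welchFloor : ℕ → ℕ
welchFloor p = welchFloorSearch p p

{-# OPTIONS --safe #-}
-- Let n = p − 1. For primitive roots a ≠ b, a correlation value N is the number of
-- x ∈ {1, …, n} with aˣ + v ≡ c bˣ (mod p), where c = bᵘ.
--
-- If v ≢ 0, an ordered pair of distinct solutions x, y is determined by δ = y − x mod n, because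
-- aˣ (aᵟ − bᵟ) ≡ v (bᵟ − 1). Here δ is neither 0 nor n/2 (at n/2 both powers are −1, so the
-- left side vanishes), hence N (N − 1) ≤ n − 2.
--
-- If v ≡ 0, the difference δ of two solutions satisfies aᵟ ≡ bᵟ. The same holds for n/2, so by
-- Bézout δ is not coprime to n/2, whence δ ≥ t and N ≤ n/t.
--
-- The value n/t is attained at u = v = 0 by a generator a and b = a^(1 + j n/t), which agree at the
-- multiples of t; one of j = 1, 2 makes 1 + j n/t coprime to n. A generator exists since the
-- largest order e of a unit is divisible by all orders, while xᵉ − 1 has at most e roots.
module Submission where

open import Defs
open import Data.Fin as Fin using (Fin; toℕ; fromℕ<; remQuot; combine; punchIn)
import Data.Fin.Properties as Fin
open import Data.Integer as ℤ using (ℤ; +_; 0ℤ; 1ℤ; _-_)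
open import Data.Integer.Divisibility.Signed as ℤ∣ using (∣ᵤ⇒∣; ∣⇒∣ᵤ)
  renaming (_∣_ to _∣ℤ_; _∣?_ to _∣ℤ?_; divides to dividesℤ)
import Data.Integer.DivMod as ℤ
import Data.Integer.Properties as ℤ
open import Data.Integer.Tactic.RingSolver using (solve-∀)
open import Data.List using (List; []; _∷_; length; lookup; map; filter; upTo; cartesianProduct; concatMap)
open import Data.List.Membership.Propositional using (_∈_; find; lose)
open import Data.List.Membership.Propositional.Properties
  using (∈-lookup; ∈-map⁺; ∈-map⁻; ∈-upTo⁺; ∈-upTo⁻; ∈-filter⁺; ∈-filter⁻; ∈-concatMap⁺; ∈-concatMap⁻;
         ∈-cartesianProduct⁺; ∈-cartesianProduct⁻)
open import Data.List.Relation.Unary.All as All using (_∷_)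
open import Data.List.Relation.Unary.AllPairs using (_∷_)
open import Data.List.Relation.Unary.Any as Any using (here; there)
import Data.List.Relation.Unary.Any.Properties as Any
open import Data.List.Relation.Unary.Unique.Propositional using (Unique)
import Data.List.Relation.Unary.Unique.Propositional.Properties as Unique
open import Data.Nat
  using (ℕ; zero; suc; _+_; _*_; _∸_; _^_; _⊔_; _≤_; _<_; z≤n; s≤s; z<s;
         NonZero; >-nonZero; >-nonZero⁻¹; nonTrivial⇒n>1)
import Data.Nat.Base as ℕ
open import Data.Nat.Coprimality as Coprimality using (Coprime; coprime-divisor; coprime-Bézout)
open import Data.Nat.Divisibility using (_∣_; divides)
import Data.Nat.Divisibility as ℕ
open import Data.Nat.DivMod using (_/_; _%_)
import Data.Nat.DivMod as ℕ
open import Data.Nat.GCD using (gcd; gcd[m,n]∣m; gcd[m,n]∣n; gcd-greatest; module Bézout)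
open import Data.Nat.Induction using (<-rec)
open import Data.Nat.ListAction using (product)
open import Data.Nat.Primality using (Prime; euclidsLemma; prime⇒nonTrivial; prime⇒nonZero; prime⇒irreducible)
open import Data.Nat.Primality.Factorisation using (factorise)
import Data.Nat.Properties as ℕ
import Data.Nat.Tactic.RingSolver as ℕ-Solver
open import Data.Product using (_×_; _,_; ∃-syntax; proj₁; proj₂; uncurry)
open import Data.Sum using (_⊎_; inj₁; inj₂; [_,_]′)
open import Data.Vec using (Vec; []; _∷_; replicate)
open import Function using (_∘_; id)
open import Relation.Binary using (Setoid)
open import Relation.Binary.Definitions using (tri<; tri≈; tri>)
open import Relation.Binary.PropositionalEquality
import Relation.Binary.Reasoning.Setoid as SetoidReasoning
open import Relation.Nullary using (¬_; Dec; yes; no; contradiction)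
open import Relation.Nullary.Decidable using (map′; decidable-stable; _×-dec_; ¬?)
open import Relation.Unary using (Decidable)

-- Integer powers and monic integer polynomials.

pos-^ : ∀ g k → + (g ^ k) ≡ (+ g) ℤ.^ k
pos-^ g zero    = refl
pos-^ g (suc k) = trans (ℤ.pos-* g (g ^ k)) (cong (+ g ℤ.*_) (pos-^ g k))

-- The coefficients are those of x⁰, …, xⁿ⁻¹; the leading coefficient 1 of xⁿ is implicit.
monicEval : ∀ {n} → Vec ℤ n → ℤ → ℤ
monicEval []       x = 1ℤ
monicEval (c ∷ cs) x = c ℤ.+ x ℤ.* monicEval cs x

-- The monic quotient of P(x) - P(a) by x - a, by Horner's scheme: each coefficient is the value at
-- `a` of a tail of the coefficient list.
syntheticQuotient : ∀ {n} → Vec ℤ (suc n) → ℤ → Vec ℤ n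
syntheticQuotient (c ∷ [])         a = []
syntheticQuotient (c ∷ cs@(_ ∷ _)) a = monicEval cs a ∷ syntheticQuotient cs a

-- With P(x) = c + x f(x), the increment is (x - a) f(a) + x (f(x) - f(a)), and by induction f(x) -
-- f(a) is a multiple of x - a.
monicEval-quotient : ∀ {n} (cs : Vec ℤ (suc n)) x a →
  monicEval cs x - monicEval cs a ≡ (x - a) ℤ.* monicEval (syntheticQuotient cs a) x
monicEval-quotient (c ∷ []) x a = lemma c x a
  where
  lemma : ∀ c x a → c ℤ.+ x ℤ.* 1ℤ - (c ℤ.+ a ℤ.* 1ℤ) ≡ (x - a) ℤ.* 1ℤ
  lemma = solve-∀
monicEval-quotient (c ∷ cs@(_ ∷ _)) x a = begin
  c ℤ.+ x ℤ.* f - (c ℤ.+ a ℤ.* g)            ≡⟨ split c x a f g ⟩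
  (x - a) ℤ.* g ℤ.+ x ℤ.* (f - g)            ≡⟨ cong (λ z → (x - a) ℤ.* g ℤ.+ x ℤ.* z) (monicEval-quotient cs x a) ⟩
  (x - a) ℤ.* g ℤ.+ x ℤ.* ((x - a) ℤ.* q)    ≡⟨ collect x a g q ⟩
  (x - a) ℤ.* (g ℤ.+ x ℤ.* q)                ∎
  where
  open ≡-Reasoning
  f = monicEval cs x
  g = monicEval cs a
  q = monicEval (syntheticQuotient cs a) x
  split : ∀ c x a f g → c ℤ.+ x ℤ.* f - (c ℤ.+ a ℤ.* g) ≡ (x - a) ℤ.* g ℤ.+ x ℤ.* (f - g)
  split = solve-∀
  collect : ∀ x a g q → (x - a) ℤ.* g ℤ.+ x ℤ.* ((x - a) ℤ.* q) ≡ (x - a) ℤ.* (g ℤ.+ x ℤ.* q)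
  collect = solve-∀

monicEval-replicate : ∀ n x → monicEval (replicate n 0ℤ) x ≡ x ℤ.^ n
monicEval-replicate zero    x = refl
monicEval-replicate (suc n) x = trans (ℤ.+-identityˡ _) (cong (x ℤ.*_) (monicEval-replicate n x))

-- Congruence of integers modulo `p`.

module Congruence (p : ℕ) .{{_ : NonZero p}} where

  infix 4 _≈_ _≈?_

  -- A record, so that `x` and `y` can be inferred from the type `x ≈ y`; the difference `x - y`
  -- alone does not determine them.
  record _≈_ (x y : ℤ) : Set where
    constructor mod
    field ∣-diff : + p ∣ℤ x - y
  open _≈_

  _≈?_ : ∀ x y → Dec (x ≈ y)
  x ≈? y = map′ mod ∣-diff (+ p ∣ℤ? x - y)

  ≈-reflexive : ∀ {x y} → x ≡ y → x ≈ y
  ≈-reflexive {x} refl = mod (dividesℤ 0ℤ (ℤ.+-inverseʳ x))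

  ≈-refl : ∀ {x} → x ≈ x
  ≈-refl = ≈-reflexive refl

  ≈-sym : ∀ {x y} → x ≈ y → y ≈ x
  ≈-sym {x} {y} (mod d) = mod (subst (+ p ∣ℤ_) (lemma x y) (ℤ∣.∣m⇒∣-m d))
    where
    lemma : ∀ x y → ℤ.- (x - y) ≡ y - x
    lemma = solve-∀

  ≈-trans : ∀ {x y z} → x ≈ y → y ≈ z → x ≈ z
  ≈-trans {x} {y} {z} (mod d) (mod e) = mod (subst (+ p ∣ℤ_) (lemma x y z) (ℤ∣.∣m∣n⇒∣m+n d e))
    where
    lemma : ∀ x y z → (x - y) ℤ.+ (y - z) ≡ x - z
    lemma = solve-∀

  ≈-setoid : Setoid _ _
  ≈-setoid = record
    { Carrier = ℤ
    ; _≈_ = _≈_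
    ; isEquivalence = record { refl = ≈-refl ; sym = ≈-sym ; trans = ≈-trans }
    }

  module ≈-Reasoning = SetoidReasoning ≈-setoid

  +-cong : ∀ {x y z w} → x ≈ y → z ≈ w → x ℤ.+ z ≈ y ℤ.+ w
  +-cong {x} {y} {z} {w} (mod d) (mod e) = mod (subst (+ p ∣ℤ_) (lemma x y z w) (ℤ∣.∣m∣n⇒∣m+n d e))
    where
    lemma : ∀ x y z w → (x - y) ℤ.+ (z - w) ≡ x ℤ.+ z - (y ℤ.+ w)
    lemma = solve-∀

  *-cong : ∀ {x y z w} → x ≈ y → z ≈ w → x ℤ.* z ≈ y ℤ.* w
  *-cong {x} {y} {z} {w} (mod d) (mod e) =
    mod (subst (+ p ∣ℤ_) (lemma x y z w) (ℤ∣.∣m∣n⇒∣m+n (ℤ∣.∣m⇒∣m*n z d) (ℤ∣.∣n⇒∣m*n y e)))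
    where
    lemma : ∀ x y z w → (x - y) ℤ.* z ℤ.+ y ℤ.* (z - w) ≡ x ℤ.* z - y ℤ.* w
    lemma = solve-∀

  *-congˡ : ∀ x {z w} → z ≈ w → x ℤ.* z ≈ x ℤ.* w
  *-congˡ x = *-cong (≈-refl {x})

  *-congʳ : ∀ z {x y} → x ≈ y → x ℤ.* z ≈ y ℤ.* z
  *-congʳ z e = *-cong e (≈-refl {z})

  ^-cong : ∀ k {x y} → x ≈ y → x ℤ.^ k ≈ y ℤ.^ k
  ^-cong zero    e = ≈-refl
  ^-cong (suc k) e = *-cong e (^-cong k e)

  ^-one : ∀ k {x} → x ≈ 1ℤ → x ℤ.^ k ≈ 1ℤ
  ^-one k e = ≈-trans (^-cong k e) (≈-reflexive (ℤ.^-zeroˡ k))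

  %ℕ-≈ : ∀ x → + (x ℤ.%ℕ p) ≈ x
  %ℕ-≈ x = ≈-sym (mod (dividesℤ (x ℤ./ℕ p)
    (trans (cong (_- + (x ℤ.%ℕ p)) (ℤ.a≡a%ℕn+[a/ℕn]*n x p)) (lemma (+ (x ℤ.%ℕ p)) (x ℤ./ℕ p ℤ.* + p)))))
    where
    lemma : ∀ r s → (r ℤ.+ s) - r ≡ s
    lemma = solve-∀

  pos-^-% : ∀ g k → + (g ^ k % p) ≈ (+ g) ℤ.^ k
  pos-^-% g k = ≈-trans (%ℕ-≈ (+ (g ^ k))) (≈-reflexive (pos-^ g k))

  -- Two numbers below `p` are less than `p` apart, and the only multiple of `p` at such a distance
  -- is 0.
  <p⇒≡ : ∀ {i j} → i < p → j < p → + i ≈ + j → i ≡ j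
  <p⇒≡ {i} {j} i<p j<p (mod d) = ℤ.+-injective (ℤ.i-j≡0⇒i≡j (+ i) (+ j) (ℤ.∣i∣≡0⇒i≡0 abs≡0))
    where
    abs<p : ℤ.∣ + i - + j ∣ < p
    abs<p = ℕ.<-≤-trans (s≤s (subst (_≤ i ⊔ j) (cong ℤ.∣_∣ (sym (ℤ.m-n≡m⊖n i j))) (ℤ.∣m⊝n∣≤m⊔n i j)))
      (ℕ.⊔-lub i<p j<p)
    abs≡0 : ℤ.∣ + i - + j ∣ ≡ 0
    abs≡0 with ℤ.∣ + i - + j ∣ | ∣⇒∣ᵤ d | abs<p
    ... | zero  | _ | _ = refl
    ... | suc k | e | l = contradiction (ℕ.∣⇒≤ e) (ℕ.<⇒≱ l)

  residue : ℤ → Fin p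
  residue x = fromℕ< (ℤ.n%ℕd<d x p)

  residue-injective : ∀ {x y} → residue x ≡ residue y → x ≈ y
  residue-injective {x} {y} eq = begin
    x              ≈⟨ %ℕ-≈ x ⟨
    + (x ℤ.%ℕ p)   ≡⟨ cong +_ (Fin.fromℕ<-injective _ _ _ _ eq) ⟩
    + (y ℤ.%ℕ p)   ≈⟨ %ℕ-≈ y ⟩
    y              ∎
    where open ≈-Reasoning

-- Prime moduli and the number of roots of a polynomial.

module PrimeModulus (n : ℕ) (p-prime : Prime (suc n)) where

  p = suc n
  open Congruence p public

  ≈0⇒∣ : ∀ {x} → x ≈ 0ℤ → + p ∣ℤ x
  ≈0⇒∣ {x} (mod d) = subst (+ p ∣ℤ_) (ℤ.+-identityʳ x) d

  ∣⇒≈0 : ∀ {x} → + p ∣ℤ x → x ≈ 0ℤ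
  ∣⇒≈0 {x} d = mod (subst (+ p ∣ℤ_) (sym (ℤ.+-identityʳ x)) d)

  *-≈0 : ∀ x y → x ℤ.* y ≈ 0ℤ → x ≈ 0ℤ ⊎ y ≈ 0ℤ
  *-≈0 x y e with euclidsLemma ℤ.∣ x ∣ ℤ.∣ y ∣ p-prime (subst (p ∣_) (ℤ.abs-* x y) (∣⇒∣ᵤ (≈0⇒∣ e)))
  ... | inj₁ d = inj₁ (∣⇒≈0 (∣ᵤ⇒∣ d))
  ... | inj₂ d = inj₂ (∣⇒≈0 (∣ᵤ⇒∣ d))

  *-cancelˡ : ∀ a {x y} → ¬ a ≈ 0ℤ → a ℤ.* x ≈ a ℤ.* y → x ≈ y
  *-cancelˡ a {x} {y} a≉0 (mod d) = [ (λ a≈0 → contradiction a≈0 a≉0) , (λ e → mod (≈0⇒∣ e)) ]′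
    (*-≈0 a (x - y) (∣⇒≈0 (subst (+ p ∣ℤ_) (lemma a x y) d)))
    where
    lemma : ∀ a x y → a ℤ.* x - a ℤ.* y ≡ a ℤ.* (x - y)
    lemma = solve-∀

  *-cancelʳ : ∀ a {x y} → ¬ a ≈ 0ℤ → x ℤ.* a ≈ y ℤ.* a → x ≈ y
  *-cancelʳ a {x} {y} a≉0 e = *-cancelˡ a a≉0 (subst₂ _≈_ (ℤ.*-comm x a) (ℤ.*-comm y a) e)

  1≉0 : ¬ 1ℤ ≈ 0ℤ
  1≉0 e with <p⇒≡ {1} {0} (>1 p-prime) z<s e
    where
    >1 : ∀ {q} → Prime q → 1 < q
    >1 {q} pq = nonTrivial⇒n>1 q {{prime⇒nonTrivial pq}}
  ... | ()

  ^-≉0 : ∀ {a} k → ¬ a ≈ 0ℤ → ¬ a ℤ.^ k ≈ 0ℤ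
  ^-≉0 zero        a≉0 e = 1≉0 e
  ^-≉0 {a} (suc k) a≉0 e with *-≈0 a (a ℤ.^ k) e
  ... | inj₁ e′ = a≉0 e′
  ... | inj₂ e′ = ^-≉0 k a≉0 e′

  pos-≉0 : ∀ {g} → 0 < g → g < p → ¬ + g ≈ 0ℤ
  pos-≉0 0<g g<p e = ℕ.<⇒≢ 0<g (sym (<p⇒≡ g<p z<s e))

  -- Lagrange's theorem: by primality, each root other than the first root `a` is a root of the
  -- quotient by x - a. The implicit leading 1 survives the division, so the induction ends at the
  -- constant 1, which has no root.
  roots≤degree : ∀ {m d} (cs : Vec ℤ d) (r : Fin m → ℤ) →
    (∀ {i j} → r i ≈ r j → i ≡ j) → (∀ i → monicEval cs (r i) ≈ 0ℤ) → m ≤ d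
  roots≤degree {zero}  cs r r-inj root = z≤n
  roots≤degree {suc m} [] r r-inj root = contradiction (root Fin.zero) 1≉0
  roots≤degree {suc m} {suc d} cs r r-inj root =
    s≤s (roots≤degree (syntheticQuotient cs a) (r ∘ Fin.suc) (Fin.suc-injective ∘ r-inj) root′)
    where
    a = r Fin.zero
    root′ : ∀ i → monicEval (syntheticQuotient cs a) (r (Fin.suc i)) ≈ 0ℤ
    root′ i = [ (λ x-a≈0 → contradiction (r-inj (mod (≈0⇒∣ x-a≈0))) λ ()) , id ]′
      (*-≈0 (x - a) (monicEval (syntheticQuotient cs a) x)
        (≈-trans (≈-reflexive (sym (monicEval-quotient cs x a)))
          (∣⇒≈0 (_≈_.∣-diff (≈-trans (root (Fin.suc i)) (≈-sym (root Fin.zero)))))))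
      where x = r (Fin.suc i)

  unity-roots≤ : ∀ {m} e .{{_ : NonZero e}} (r : Fin m → ℤ) →
    (∀ {i j} → r i ≈ r j → i ≡ j) → (∀ i → r i ℤ.^ e ≈ 1ℤ) → m ≤ e
  -- The vector holds the coefficients of xᵉ⁺¹ - 1 below the leading one.
  unity-roots≤ (suc e) r r-inj root = roots≤degree (ℤ.- 1ℤ ∷ replicate e 0ℤ) r r-inj λ i →
    ≈-trans (≈-reflexive (cong (λ z → ℤ.- 1ℤ ℤ.+ r i ℤ.* z) (monicEval-replicate e (r i))))
      (+-cong (≈-refl {ℤ.- 1ℤ}) (root i))

-- Prime factors and coprimality.

^-monoʳ-∣ : ∀ q {j i} → j ≤ i → q ^ j ∣ q ^ i
^-monoʳ-∣ q {i = i} z≤n   = ℕ.1∣ (q ^ i)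
^-monoʳ-∣ q (s≤s j≤i) = ℕ.*-monoʳ-∣ q (^-monoʳ-∣ q j≤i)

prime-divisor : ∀ m → 1 < m → ∃[ q ] Prime q × q ∣ m
prime-divisor m@(suc _) 1<m with factorise m
... | record { factors = [] ; isFactorisation = m≡1 } = contradiction m≡1 (ℕ.>⇒≢ 1<m)
... | record { factors = q ∷ qs ; isFactorisation = eq ; factorsPrime = q-prime ∷ _ } =
  q , q-prime , divides (product qs) (trans eq (ℕ.*-comm q (product qs)))

extract-prime-power : ∀ {q} → Prime q → ∀ e → 0 < e → ∃[ i ] ∃[ e′ ] e ≡ q ^ i * e′ × ¬ q ∣ e′
extract-prime-power {q} q-prime = <-rec _ step
  where
  step : ∀ e → (∀ {d} → d < e → 0 < d → ∃[ i ] ∃[ e′ ] d ≡ q ^ i * e′ × ¬ q ∣ e′) →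
    0 < e → ∃[ i ] ∃[ e′ ] e ≡ q ^ i * e′ × ¬ q ∣ e′
  step e rec 0<e with q ℕ.∣? e
  ... | no q∤e = 0 , e , sym (ℕ.*-identityˡ e) , q∤e
  ... | yes (divides zero eq) = contradiction eq (ℕ.>⇒≢ 0<e)
  ... | yes (divides d@(suc _) eq)
    with rec (subst (d <_) (sym eq) (ℕ.m<m*n d q (nonTrivial⇒n>1 q {{prime⇒nonTrivial q-prime}}))) z<s
  ...   | i , e′ , d≡ , q∤e′ =
    suc i , e′ , trans eq (trans (ℕ.*-comm d q) (trans (cong (q *_) d≡) (sym (ℕ.*-assoc q (q ^ i) e′)))) , q∤e′

prime-coprime : ∀ {q m} → Prime q → ¬ q ∣ m → Coprime q m
prime-coprime q-prime q∤m (d∣q , d∣m) with prime⇒irreducible q-prime d∣q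
... | inj₁ d≡1  = d≡1
... | inj₂ refl = contradiction d∣m q∤m

-- A common divisor `d` of a b and `m` is coprime to `a`, since whatever divides `d` divides `m`;
-- hence `d` divides `b` as well as `m`.
coprime-* : ∀ {a b m} → Coprime a m → Coprime b m → Coprime (a * b) m
coprime-* {a} {b} {m} a⊥m b⊥m {d} (d∣ab , d∣m) = b⊥m (coprime-divisor d⊥a d∣ab , d∣m)
  where
  d⊥a : Coprime d a
  d⊥a (c∣d , c∣a) = a⊥m (c∣a , ℕ.∣-trans c∣d d∣m)

coprime-^ : ∀ {a m} i → Coprime a m → Coprime (a ^ i) m
coprime-^ {m = m} zero    a⊥m = Coprimality.1-coprimeTo m
coprime-^         (suc i) a⊥m = coprime-* a⊥m (coprime-^ i a⊥m)

^-distribʳ-* : ∀ k x y → (x ℤ.* y) ℤ.^ k ≡ x ℤ.^ k ℤ.* y ℤ.^ k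
^-distribʳ-* zero    x y = refl
^-distribʳ-* (suc k) x y = trans (cong (x ℤ.* y ℤ.*_) (^-distribʳ-* k x y)) (lemma x y (x ℤ.^ k) (y ℤ.^ k))
  where
  lemma : ∀ x y a b → x ℤ.* y ℤ.* (a ℤ.* b) ≡ x ℤ.* a ℤ.* (y ℤ.* b)
  lemma = solve-∀

-- Multiplicative orders and the existence of a generator.

module MultiplicativeOrder (n : ℕ) (p-prime : Prime (suc n)) where

  open PrimeModulus n p-prime

  ^-*-one : ∀ a m k → a ℤ.^ m ≈ 1ℤ → a ℤ.^ (m * k) ≈ 1ℤ
  ^-*-one a m k eq = ≈-trans (≈-reflexive (sym (ℤ.^-*-assoc a m k))) (^-one k eq)

  -- Minimality takes the form of divisibility, in which it is applied; `least⇒order` obtains it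
  -- from leastness.
  record Order (a : ℤ) (e : ℕ) : Set where
    field
      order>0 : 0 < e
      ^-order : a ℤ.^ e ≈ 1ℤ
      minimal : ∀ k → a ℤ.^ k ≈ 1ℤ → e ∣ k
  open Order public

  order⇒≉0 : ∀ {a e} → Order a e → ¬ a ≈ 0ℤ
  order⇒≉0 {a} {suc e} o a≈0 = 1≉0 (≈-trans (≈-sym (^-order o)) (*-congʳ (a ℤ.^ e) a≈0))
  order⇒≉0 {a} {zero} o = contradiction (order>0 o) λ ()

  ^-% : ∀ {a e} .{{_ : NonZero e}} k → a ℤ.^ e ≈ 1ℤ → a ℤ.^ (k % e) ≈ a ℤ.^ k
  ^-% {a} {e} k aᵉ≈1 = ≈-sym (begin
    a ℤ.^ k                                      ≡⟨ cong (a ℤ.^_) (ℕ.m≡m%n+[m/n]*n k e) ⟩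
    a ℤ.^ (k % e + k / e * e)                    ≡⟨ ℤ.^-distribˡ-+-* a (k % e) _ ⟩
    a ℤ.^ (k % e) ℤ.* a ℤ.^ (k / e * e)          ≡⟨ cong (λ i → a ℤ.^ (k % e) ℤ.* a ℤ.^ i) (ℕ.*-comm (k / e) e) ⟩
    a ℤ.^ (k % e) ℤ.* a ℤ.^ (e * (k / e))        ≈⟨ *-congˡ (a ℤ.^ (k % e)) (^-*-one a e (k / e) aᵉ≈1) ⟩
    a ℤ.^ (k % e) ℤ.* 1ℤ                         ≡⟨ ℤ.*-identityʳ _ ⟩
    a ℤ.^ (k % e)                                ∎)
    where open ≈-Reasoning

  -- The remainder of `k` modulo `e` is again an exponent with power 1, and it lies below `e`, so it
  -- is 0.
  least⇒order : ∀ {a e} → 0 < e → a ℤ.^ e ≈ 1ℤ → (∀ k → 0 < k → k < e → ¬ a ℤ.^ k ≈ 1ℤ) → Order a e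
  least⇒order {a} {e@(suc _)} 0<e aᵉ≈1 least = record
    { order>0 = 0<e
    ; ^-order = aᵉ≈1
    ; minimal = λ k aᵏ≈1 → ℕ.m%n≡0⇒n∣m k e (remainder≡0 k (≈-trans (^-% k aᵉ≈1) aᵏ≈1))
    }
    where
    remainder≡0 : ∀ k → a ℤ.^ (k % e) ≈ 1ℤ → k % e ≡ 0
    remainder≡0 k eq with k % e | ℕ.m%n<n k e
    ... | zero  | _ = refl
    ... | suc r | l = contradiction eq (least (suc r) z<s l)

  ^-∸ : ∀ {a i j} → ¬ a ≈ 0ℤ → i ≤ j → a ℤ.^ i ≈ a ℤ.^ j → a ℤ.^ (j ∸ i) ≈ 1ℤ
  ^-∸ {a} {i} {j} a≉0 i≤j eq = *-cancelˡ (a ℤ.^ i) (^-≉0 i a≉0) (begin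
    a ℤ.^ i ℤ.* a ℤ.^ (j ∸ i)   ≡⟨ ℤ.^-distribˡ-+-* a i (j ∸ i) ⟨
    a ℤ.^ (i + (j ∸ i))         ≡⟨ cong (a ℤ.^_) (ℕ.m+[n∸m]≡n i≤j) ⟩
    a ℤ.^ j                     ≈⟨ eq ⟨
    a ℤ.^ i                     ≡⟨ ℤ.*-identityʳ _ ⟨
    a ℤ.^ i ℤ.* 1ℤ              ∎)
    where open ≈-Reasoning

  -- Pigeonhole on 0, a⁰, …, aⁿ, which are p + 1 representatives of p residue classes.
  power≈1 : ∀ a → ¬ a ≈ 0ℤ → ∃[ k ] 0 < k × k < p × a ℤ.^ k ≈ 1ℤ
  power≈1 a a≉0 with Fin.pigeonhole (ℕ.n<1+n p) f
    where
    f : Fin (suc p) → Fin p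
    f Fin.zero    = residue 0ℤ
    f (Fin.suc i) = residue (a ℤ.^ toℕ i)
  ... | Fin.zero  , Fin.suc j , _       , eq =
    contradiction (≈-sym (residue-injective eq)) (^-≉0 (toℕ j) a≉0)
  ... | Fin.suc i , Fin.suc j , s≤s i<j , eq =
    toℕ j ∸ toℕ i , ℕ.m<n⇒0<n∸m i<j , ℕ.≤-<-trans (ℕ.m∸n≤m (toℕ j) (toℕ i)) (Fin.toℕ<n j) ,
    ^-∸ a≉0 (ℕ.<⇒≤ i<j) (residue-injective eq)

  -- Descend from the exponent of `power≈1` to smaller positive exponents with power 1 until none is
  -- left; the bound by `p` is carried along.
  order-exists : ∀ {a} → ¬ a ≈ 0ℤ → ∃[ e ] e < p × Order a e
  order-exists {a} a≉0 with power≈1 a a≉0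
  ... | k , 0<k , k<p , aᵏ≈1 = <-rec _ step k 0<k k<p aᵏ≈1
    where
    step : ∀ k → (∀ {i} → i < k → 0 < i → i < p → a ℤ.^ i ≈ 1ℤ → ∃[ e ] e < p × Order a e) →
      0 < k → k < p → a ℤ.^ k ≈ 1ℤ → ∃[ e ] e < p × Order a e
    step k rec 0<k k<p aᵏ≈1 with ℕ.anyUpTo? (λ i → (0 ℕ.<? i) ×-dec (a ℤ.^ i ≈? 1ℤ)) k
    ... | yes (i , i<k , 0<i , aⁱ≈1) = rec i<k 0<i (ℕ.<-trans i<k k<p) aⁱ≈1
    ... | no none = k , k<p , least⇒order 0<k aᵏ≈1 (λ i 0<i i<k aⁱ≈1 → none (i , i<k , 0<i , aⁱ≈1))

  -- `order-exists` supplies an order of `a` below `p`, and `e` divides it.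
  order<p : ∀ {a e} → Order a e → e < p
  order<p {a} {e} o with order-exists (order⇒≉0 o)
  ... | suc f , f<p , o′ = ℕ.≤-<-trans (ℕ.∣⇒≤ (minimal o (suc f) (^-order o′))) f<p
  ... | zero  , f<p , o′ = contradiction (order>0 o′) λ ()

  order-^ : ∀ {a} m {e} → Order a (m * e) → Order (a ℤ.^ m) e
  order-^ {a} m {e} o = record
    { order>0 = ℕ.n≢0⇒n>0 λ { refl → ℕ.n>0⇒n≢0 (order>0 o) (ℕ.*-zeroʳ m) }
    ; ^-order = ≈-trans (≈-reflexive (ℤ.^-*-assoc a m e)) (^-order o)
    ; minimal = λ k eq → ℕ.*-cancelˡ-∣ m {{m≢0}}
        (minimal o (m * k) (≈-trans (≈-reflexive (sym (ℤ.^-*-assoc a m k))) eq))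
    }
    where
    m≢0 : NonZero m
    m≢0 = ℕ.≢-nonZero λ { refl → ℕ.n>0⇒n≢0 (order>0 o) refl }

  ^-multiple : ∀ {a e k} → Order a e → e ∣ k → a ℤ.^ k ≈ 1ℤ
  ^-multiple {a} {e} o (divides i refl) =
    ≈-trans (≈-reflexive (cong (a ℤ.^_) (ℕ.*-comm i e))) (^-*-one a e i (^-order o))

  order-coprime-^ : ∀ {a e} r → Order a e → Coprime e r → Order (a ℤ.^ r) e
  order-coprime-^ {a} {e} r o e⊥r = record
    { order>0 = order>0 o
    ; ^-order = ≈-trans (≈-reflexive (ℤ.^-*-assoc a r e)) (^-multiple o (ℕ.n∣m*n r))
    ; minimal = λ k eq → coprime-divisor e⊥r (minimal o (r * k) (≈-trans (≈-reflexive (sym (ℤ.^-*-assoc a r k))) eq))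
    }

  -- Raising (a b)ᵏ ≡ 1 to the power `f` eliminates `b` and leaves `e` dividing f k; coprimality
  -- then removes `f`.
  order-*-∣ : ∀ {a b e f} → Order a e → Order b f → Coprime e f → ∀ k → (a ℤ.* b) ℤ.^ k ≈ 1ℤ → e ∣ k
  order-*-∣ {a} {b} {e} {f} oa ob e⊥f k eq = coprime-divisor e⊥f (minimal oa (f * k) (begin
    a ℤ.^ (f * k)                        ≡⟨ ℤ.*-identityʳ _ ⟨
    a ℤ.^ (f * k) ℤ.* 1ℤ                 ≈⟨ *-congˡ (a ℤ.^ (f * k)) (^-*-one b f k (^-order ob)) ⟨
    a ℤ.^ (f * k) ℤ.* b ℤ.^ (f * k)      ≡⟨ ^-distribʳ-* (f * k) a b ⟨
    (a ℤ.* b) ℤ.^ (f * k)                ≡⟨ cong ((a ℤ.* b) ℤ.^_) (ℕ.*-comm f k) ⟩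
    (a ℤ.* b) ℤ.^ (k * f)                ≈⟨ ^-*-one (a ℤ.* b) k f eq ⟩
    1ℤ                                   ∎))
    where open ≈-Reasoning

  order-* : ∀ {a b e f} → Order a e → Order b f → Coprime e f → Order (a ℤ.* b) (e * f)
  order-* {a} {b} {e} {f} oa ob e⊥f = record
    { order>0 = ℕ.*-mono-≤ (order>0 oa) (order>0 ob)
    ; ^-order = begin
        (a ℤ.* b) ℤ.^ (e * f)              ≡⟨ ^-distribʳ-* (e * f) a b ⟩
        a ℤ.^ (e * f) ℤ.* b ℤ.^ (e * f)    ≈⟨ *-cong (^-multiple oa (ℕ.m∣m*n f)) (^-multiple ob (ℕ.n∣m*n e)) ⟩
        1ℤ                                 ∎
    ; minimal = λ k eq → product-∣ k (order-*-∣ oa ob e⊥f k eq)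
        (order-*-∣ ob oa (Coprimality.sym e⊥f) k
          (≈-trans (≈-reflexive (cong (ℤ._^ k) (ℤ.*-comm b a))) eq))
    }
    where
    open ≈-Reasoning
    product-∣ : ∀ k → e ∣ k → f ∣ k → e * f ∣ k
    product-∣ k (divides c k≡ce) f∣k = subst (e * f ∣_) (trans (ℕ.*-comm e c) (sym k≡ce))
      (ℕ.*-monoʳ-∣ e (coprime-divisor (Coprimality.sym e⊥f) (subst (f ∣_) (trans k≡ce (ℕ.*-comm c e)) f∣k)))

  -- Some prime q has higher multiplicity in f than in e = qⁱe′ (q ∤ e′), and then
  -- a^(qⁱ), of order e′, times a power of b of order qⁱ⁺¹ has order q e.
  larger-order : ∀ {a b e f} → Order a e → Order b f → ¬ f ∣ e → ∃[ c ] ∃[ d ] e < d × Order c d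
  larger-order {a} {b} {e} {f} oa ob f∤e = larger
    where
    instance
      e≢0 : NonZero e
      e≢0 = >-nonZero (order>0 oa)
    g = gcd f e
    -- `h` = f / gcd(f, e) exceeds 1 because `f` does not divide `e`; any prime factor of `h` serves
    -- as `q`.
    h = ℕ.quotient (gcd[m,n]∣m f e)
    f≡hg : f ≡ h * g
    f≡hg = _∣_.equality (gcd[m,n]∣m f e)
    1<h : 1 < h
    1<h with h in h≡
    ... | zero  = contradiction (trans f≡hg (cong (_* g) h≡)) (ℕ.>⇒≢ (order>0 ob))
    ... | suc zero = contradiction
      (subst (_∣ e) (sym (trans f≡hg (trans (cong (_* g) h≡) (ℕ.*-identityˡ g)))) (gcd[m,n]∣n f e)) f∤e
    ... | suc (suc _) = s≤s (s≤s z≤n)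
    larger : ∃[ c ] ∃[ d ] e < d × Order c d
    larger with prime-divisor h 1<h
    ... | q , q-prime , q∣h with extract-prime-power q-prime e (order>0 oa)
    ...   | i , e′ , e≡ , q∤e′ = _ , _ , e< , order-* (order-^ (q ^ i) (subst (Order a) e≡ oa))
              (order-^ r (subst (Order b) f≡ ob))
              (Coprimality.sym (coprime-^ (suc i) (prime-coprime q-prime q∤e′)))
      where
      -- If qʲ divides `f` and `e`, it divides their gcd `g`, so qʲ⁺¹ divides h g = f. This can be
      -- repeated while j ≤ i, as qⁱ divides `e`.
      q^∣f : ∀ j → j ≤ suc i → q ^ j ∣ f
      q^∣f zero    _         = ℕ.1∣ f
      q^∣f (suc j) (s≤s j≤i) = subst (q ^ suc j ∣_) (sym f≡hg)
        (ℕ.*-pres-∣ q∣h (gcd-greatest (q^∣f j (ℕ.m≤n⇒m≤1+n j≤i))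
          (subst (q ^ j ∣_) (sym e≡) (ℕ.∣m⇒∣m*n e′ (^-monoʳ-∣ q j≤i)))))
      r = ℕ.quotient (q^∣f (suc i) ℕ.≤-refl)
      f≡ : f ≡ r * q ^ suc i
      f≡ = _∣_.equality (q^∣f (suc i) ℕ.≤-refl)
      e< : e < e′ * q ^ suc i
      e< = subst (e <_) (trans (cong (_* q) e≡) (lemma (q ^ i) e′ q))
        (ℕ.m<m*n e q (nonTrivial⇒n>1 q {{prime⇒nonTrivial q-prime}}))
        where
        lemma : ∀ x y z → x * y * z ≡ y * (z * x)
        lemma = ℕ-Solver.solve-∀

  -- Climb from the element 1 of order 1. A residue `b` with bᵉ ≢ 1 has an order not dividing `e`,
  -- so `larger-order` applies. Without such a residue, 1, ..., n are roots of xᵉ - 1, whence n ≤ e.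
  generator : ∃[ a ] Order a n
  generator = climb n 1ℤ 1 (record { order>0 = z<s ; ^-order = ≈-refl ; minimal = λ k _ → ℕ.1∣ k }) (ℕ.n≤1+n n)
    where
    -- Each round raises `e` and uses one unit of fuel, which preserves n ≤ e + fuel. A further rise
    -- at fuel 0 would produce an order above `n`, against `order<p`.
    climb : ∀ fuel a e → Order a e → n ≤ e + fuel → ∃[ a ] Order a n
    climb fuel a e o n≤ with ℕ.anyUpTo? (λ i → (¬? ((+ suc i) ℤ.^ e ≈? 1ℤ))) n
    ... | no none = a , subst (Order a) (ℕ.≤-antisym (ℕ.≤-pred (order<p o)) n≤e) o
      where
      n≤e : n ≤ e
      n≤e = unity-roots≤ e {{>-nonZero (order>0 o)}} (λ i → + suc (toℕ {n} i))
        (λ {i} {j} eq → Fin.toℕ-injective (ℕ.suc-injective (<p⇒≡ (s≤s (Fin.toℕ<n i)) (s≤s (Fin.toℕ<n j)) eq)))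
        (λ i → decidable-stable ((+ suc (toℕ i)) ℤ.^ e ≈? 1ℤ) (λ ne → none (toℕ i , Fin.toℕ<n i , ne)))
    ... | yes (i , i<n , bᵉ≉1) with order-exists (pos-≉0 {suc i} z<s (s≤s i<n))
    ...   | f , _ , o′ with larger-order o o′ (bᵉ≉1 ∘ ^-multiple o′)
    ...     | c , d , e<d , o″ with fuel
    ...       | zero    = contradiction (ℕ.≤-pred (order<p o″))
        (ℕ.<⇒≱ (ℕ.≤-<-trans (subst (n ≤_) (ℕ.+-identityʳ e) n≤) e<d))
    ...       | suc fu  = climb fu c d o″ (ℕ.≤-trans (subst (n ≤_) (ℕ.+-suc e fu) n≤) (ℕ.+-monoˡ-≤ fu e<d))

-- Counting by injections from duplicate-free lists.

lookup-injective : ∀ {A : Set} {xs : List A} → Unique xs → ∀ {i j} → lookup xs i ≡ lookup xs j → i ≡ j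
lookup-injective (x∉xs ∷ u) {Fin.zero}  {Fin.zero}  eq = refl
lookup-injective (x∉xs ∷ u) {Fin.zero}  {Fin.suc j} eq = contradiction eq (All.lookup x∉xs (∈-lookup j))
lookup-injective (x∉xs ∷ u) {Fin.suc i} {Fin.zero}  eq = contradiction (sym eq) (All.lookup x∉xs (∈-lookup i))
lookup-injective (x∉xs ∷ u) {Fin.suc i} {Fin.suc j} eq = cong Fin.suc (lookup-injective u eq)

length≤ : ∀ {A : Set} {xs : List A} {m} → Unique xs → (f : A → ℕ) → (∀ {x} → x ∈ xs → f x < m) →
  (∀ {x y} → x ∈ xs → y ∈ xs → f x ≡ f y → x ≡ y) → length xs ≤ m
length≤ {xs = xs} u f f<m f-inj = Fin.injective⇒≤ {f = λ i → fromℕ< (f<m (∈-lookup {xs = xs} i))}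
  (λ {i} {j} eq → lookup-injective u (f-inj (∈-lookup i) (∈-lookup j) (Fin.fromℕ<-injective _ _ _ _ eq)))

-- A pair of distinct positions is coded by the first position and, through `punchIn`, an index
-- among the others. These codes and two extra points for the avoided values `z₁`, `z₂` inject into
-- `Fin m`.
ordered-pairs≤ : ∀ {A : Set} {x₀ : A} {xs : List A} {m} → let X = x₀ ∷ xs in
  Unique X → (f : A → A → Fin m) {z₁ z₂ : Fin m} → z₁ ≢ z₂ →
  (∀ {x y} → x ∈ X → y ∈ X → x ≢ y → f x y ≢ z₁ × f x y ≢ z₂) →
  (∀ {x y x′ y′} → x ∈ X → y ∈ X → x′ ∈ X → y′ ∈ X → x ≢ y → x′ ≢ y′ →
    f x y ≡ f x′ y′ → x ≡ x′ × y ≡ y′) →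
  2 + length X * length xs ≤ m
ordered-pairs≤ {A} {x₀} {xs} {m} u f {z₁} {z₂} z₁≢z₂ avoids f-inj = Fin.injective⇒≤ {f = g} g-inj
  where
  X = x₀ ∷ xs
  N = length xs
  first second : Fin (suc N) × Fin N → Fin (suc N)
  first  (i , j) = i
  second (i , j) = punchIn i j
  value : Fin (suc N) × Fin N → Fin m
  value ij = f (lookup X (first ij)) (lookup X (second ij))
  distinct : ∀ ij → lookup X (first ij) ≢ lookup X (second ij)
  distinct (i , j) eq = Fin.punchInᵢ≢i i j (sym (lookup-injective u eq))
  value-avoids : ∀ ij → value ij ≢ z₁ × value ij ≢ z₂
  value-avoids ij = avoids (∈-lookup (first ij)) (∈-lookup (second ij)) (distinct ij)
  value-inj : ∀ ij ij′ → value ij ≡ value ij′ → ij ≡ ij′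
  value-inj (i , j) (i′ , j′) eq
    with f-inj (∈-lookup i) (∈-lookup (punchIn i j)) (∈-lookup i′) (∈-lookup (punchIn i′ j′))
           (distinct (i , j)) (distinct (i′ , j′)) eq
  ... | eq₁ , eq₂ with lookup-injective u {i} {i′} eq₁
  ...   | refl = cong (i ,_) (Fin.punchIn-injective i j j′ (lookup-injective u eq₂))
  split : Fin (suc N * N) → Fin (suc N) × Fin N
  split = remQuot N
  g : Fin (2 + suc N * N) → Fin m
  g Fin.zero              = z₁
  g (Fin.suc Fin.zero)    = z₂
  g (Fin.suc (Fin.suc k)) = value (split k)
  g-inj : ∀ {i j} → g i ≡ g j → i ≡ j
  g-inj {Fin.zero}              {Fin.zero}              eq = refl
  g-inj {Fin.zero}              {Fin.suc Fin.zero}      eq = contradiction eq z₁≢z₂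
  g-inj {Fin.zero}              {Fin.suc (Fin.suc l)}   eq = contradiction (sym eq) (proj₁ (value-avoids (split l)))
  g-inj {Fin.suc Fin.zero}      {Fin.zero}              eq = contradiction (sym eq) z₁≢z₂
  g-inj {Fin.suc Fin.zero}      {Fin.suc Fin.zero}      eq = refl
  g-inj {Fin.suc Fin.zero}      {Fin.suc (Fin.suc l)}   eq = contradiction (sym eq) (proj₂ (value-avoids (split l)))
  g-inj {Fin.suc (Fin.suc k)}   {Fin.zero}              eq = contradiction eq (proj₁ (value-avoids (split k)))
  g-inj {Fin.suc (Fin.suc k)}   {Fin.suc Fin.zero}      eq = contradiction eq (proj₂ (value-avoids (split k)))
  g-inj {Fin.suc (Fin.suc k)}   {Fin.suc (Fin.suc l)}   eq = cong (λ i → Fin.suc (Fin.suc i)) (begin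
    k                            ≡⟨ Fin.combine-remQuot N k ⟨
    uncurry combine (split k)    ≡⟨ cong (uncurry combine) (value-inj (split k) (split l) eq) ⟩
    uncurry combine (split l)    ≡⟨ Fin.combine-remQuot N l ⟩
    l                            ∎)
    where open ≡-Reasoning

-- Powers of an element of given order.

module PrimitiveElements (n : ℕ) (p-prime : Prime (suc n)) where

  open PrimeModulus n p-prime
  open MultiplicativeOrder n p-prime

  -- Exponents range over 1, ..., e, like the arguments of the permutations, so j - i is positive
  -- and below `e`, hence no multiple of `e`.
  powers-distinct : ∀ {a e i j} → Order a e → 0 < i → j ≤ e → i < j → ¬ a ℤ.^ i ≈ a ℤ.^ j
  powers-distinct {i = i} {j} o 0<i j≤e i<j eq = contradiction
    (ℕ.∣⇒≤ {{>-nonZero (ℕ.m<n⇒0<n∸m i<j)}} (minimal o (j ∸ i) (^-∸ (order⇒≉0 o) (ℕ.<⇒≤ i<j) eq)))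
    (ℕ.<⇒≱ (ℕ.<-≤-trans (ℕ.∸-monoʳ-< 0<i (ℕ.<⇒≤ i<j)) j≤e))

  order-injective : ∀ {a e} → Order a e → ∀ {i j} → 0 < i → i ≤ e → 0 < j → j ≤ e →
    a ℤ.^ i ≈ a ℤ.^ j → i ≡ j
  order-injective o {i} {j} 0<i i≤e 0<j j≤e eq with ℕ.<-cmp i j
  ... | tri< i<j _ _ = contradiction eq (powers-distinct o 0<i j≤e i<j)
  ... | tri≈ _ i≡j _ = i≡j
  ... | tri> _ _ i>j = contradiction (≈-sym eq) (powers-distinct o 0<j i≤e i>j)

  -- aʰ is a square root of 1, and it is not 1 because 2h does not divide `h`; modulo a prime only
  -- -1 is left.
  ^-half : ∀ {a} h → Order a (h + h) → a ℤ.^ h ≈ ℤ.- 1ℤ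
  ^-half {a} zero      o = contradiction (order>0 o) λ ()
  ^-half {a} h@(suc _) o = [ (λ e → contradiction (minimal o h (mod (≈0⇒∣ e)))
                                     (ℕ.>⇒∤ (ℕ.m<m+n h z<s))) , (λ e → mod (≈0⇒∣ e)) ]′
    (*-≈0 (a ℤ.^ h - 1ℤ) (a ℤ.^ h - (ℤ.- 1ℤ)) (∣⇒≈0 (subst (+ p ∣ℤ_)
      (trans (cong (_- 1ℤ) (ℤ.^-distribˡ-+-* a h h)) (lemma (a ℤ.^ h))) (_≈_.∣-diff (^-order o)))))
    where
    lemma : ∀ x → x ℤ.* x - 1ℤ ≡ (x - 1ℤ) ℤ.* (x - (ℤ.- 1ℤ))
    lemma = solve-∀

-- The number of solutions of aˣ + v ≡ c bˣ.

module Solutions (n : ℕ) (p-prime : Prime (suc n)) where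

  open PrimeModulus n p-prime
  open MultiplicativeOrder n p-prime
  open PrimitiveElements n p-prime

  module _ {a b : ℤ} (oa : Order a n) (ob : Order b n) {h : ℕ} (n≡h+h : n ≡ h + h)
    (c v : ℤ) {X : List ℕ} (X-unique : Unique X)
    (bounds : ∀ {x} → x ∈ X → 0 < x × x ≤ n)
    (solution : ∀ {x} → x ∈ X → a ℤ.^ x ℤ.+ v ≈ c ℤ.* b ℤ.^ x) where

    private instance
      n≢0 : NonZero n
      n≢0 = >-nonZero (order>0 oa)

    halves-agree : a ℤ.^ h ≈ b ℤ.^ h
    halves-agree = ≈-trans (^-half h (subst (Order a) n≡h+h oa)) (≈-sym (^-half h (subst (Order b) n≡h+h ob)))

    0<h : 0 < h
    0<h = ℕ.n≢0⇒n>0 λ h≡0 → ℕ.n>0⇒n≢0 (order>0 oa) (trans n≡h+h (cong (λ k → k + k) h≡0))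

    h<n : h < n
    h<n = subst (h <_) (sym n≡h+h) (ℕ.m<m+n h 0<h)

    -- The residue of y - x modulo `n`; adding `n` first keeps the truncated subtraction exact for x
    -- ≤ n.
    δ : ℕ → ℕ → ℕ
    δ x y = (y + n ∸ x) % n

    ^-δ : ∀ {e x} y → Order e n → x ≤ n → e ℤ.^ x ℤ.* e ℤ.^ δ x y ≈ e ℤ.^ y
    ^-δ {e} {x} y o x≤n = begin
      e ℤ.^ x ℤ.* e ℤ.^ δ x y            ≈⟨ *-congˡ (e ℤ.^ x) (^-% (y + n ∸ x) (^-order o)) ⟩
      e ℤ.^ x ℤ.* e ℤ.^ (y + n ∸ x)      ≡⟨ ℤ.^-distribˡ-+-* e x (y + n ∸ x) ⟨
      e ℤ.^ (x + (y + n ∸ x))            ≡⟨ cong (e ℤ.^_) (ℕ.m+[n∸m]≡n (ℕ.≤-trans x≤n (ℕ.m≤n+m n y))) ⟩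
      e ℤ.^ (y + n)                      ≡⟨ ℤ.^-distribˡ-+-* e y n ⟩
      e ℤ.^ y ℤ.* e ℤ.^ n                ≈⟨ *-congˡ (e ℤ.^ y) (^-order o) ⟩
      e ℤ.^ y ℤ.* 1ℤ                     ≡⟨ ℤ.*-identityʳ _ ⟩
      e ℤ.^ y                            ∎
      where open ≈-Reasoning

    δ≢0 : ∀ {x y} → x ∈ X → y ∈ X → x ≢ y → δ x y ≢ 0
    δ≢0 {x} {y} x∈X y∈X x≢y δ≡0 with bounds x∈X | bounds y∈X
    ... | 0<x , x≤n | 0<y , y≤n = x≢y (order-injective oa 0<x x≤n 0<y y≤n (begin
      a ℤ.^ x                      ≡⟨ ℤ.*-identityʳ _ ⟨
      a ℤ.^ x ℤ.* 1ℤ               ≡⟨ cong (λ d → a ℤ.^ x ℤ.* a ℤ.^ d) δ≡0 ⟨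
      a ℤ.^ x ℤ.* a ℤ.^ δ x y      ≈⟨ ^-δ y oa x≤n ⟩
      a ℤ.^ y                      ∎))
      where open ≈-Reasoning

    module _ (v≉0 : ¬ v ≈ 0ℤ) where

      -- Subtracting β (A + v) = c B β from A α + v = c B β, where α = aᵟ and β = bᵟ.
      pair-equation : ∀ {x y} → x ∈ X → y ∈ X → let α = a ℤ.^ δ x y; β = b ℤ.^ δ x y in
        a ℤ.^ x ℤ.* (α - β) ≈ v ℤ.* (β - 1ℤ)
      pair-equation {x} {y} x∈X y∈X = begin
        A ℤ.* (α - β)                                  ≡⟨ lemma₁ A α β v ⟩
        (A ℤ.* α ℤ.+ v) ℤ.+ ((ℤ.- β) ℤ.* A - v)        ≈⟨ +-cong (+-cong (^-δ y oa x≤n) (≈-refl {v})) ≈-refl ⟩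
        (a ℤ.^ y ℤ.+ v) ℤ.+ ((ℤ.- β) ℤ.* A - v)        ≈⟨ +-cong (solution y∈X) ≈-refl ⟩
        c ℤ.* b ℤ.^ y ℤ.+ ((ℤ.- β) ℤ.* A - v)          ≈⟨ +-cong (*-congˡ c (^-δ y ob x≤n)) ≈-refl ⟨
        c ℤ.* (B ℤ.* β) ℤ.+ ((ℤ.- β) ℤ.* A - v)        ≡⟨ lemma₂ A B β c v ⟩
        β ℤ.* (c ℤ.* B) ℤ.+ ((ℤ.- β) ℤ.* A - v)        ≈⟨ +-cong (*-congˡ β (solution x∈X)) ≈-refl ⟨
        β ℤ.* (A ℤ.+ v) ℤ.+ ((ℤ.- β) ℤ.* A - v)        ≡⟨ lemma₃ A β v ⟩
        v ℤ.* (β - 1ℤ)                                 ∎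
        where
        open ≈-Reasoning
        x≤n = proj₂ (bounds x∈X)
        A = a ℤ.^ x
        B = b ℤ.^ x
        α = a ℤ.^ δ x y
        β = b ℤ.^ δ x y
        lemma₁ : ∀ A α β v → A ℤ.* (α - β) ≡ (A ℤ.* α ℤ.+ v) ℤ.+ ((ℤ.- β) ℤ.* A - v)
        lemma₁ = solve-∀
        lemma₂ : ∀ A B β c v → c ℤ.* (B ℤ.* β) ℤ.+ ((ℤ.- β) ℤ.* A - v) ≡ β ℤ.* (c ℤ.* B) ℤ.+ ((ℤ.- β) ℤ.* A - v)
        lemma₂ = solve-∀
        lemma₃ : ∀ A β v → β ℤ.* (A ℤ.+ v) ℤ.+ ((ℤ.- β) ℤ.* A - v) ≡ v ℤ.* (β - 1ℤ)
        lemma₃ = solve-∀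

      -- Otherwise `pair-equation` gives v (β - 1) ≡ 0. As v ≢ 0, this means β = bᵟ ≡ 1, impossible
      -- for 0 < δ < n since `b` has order `n`.
      powers-differ : ∀ {x y} → x ∈ X → y ∈ X → x ≢ y → ¬ (a ℤ.^ δ x y - b ℤ.^ δ x y ≈ 0ℤ)
      powers-differ {x} {y} x∈X y∈X x≢y e =
        [ v≉0 , (λ β≈1 → ℕ.>⇒∤ {{ℕ.≢-nonZero (δ≢0 x∈X y∈X x≢y)}} (ℕ.m%n<n (y + n ∸ x) n)
                           (minimal ob _ (mod (≈0⇒∣ β≈1)))) ]′
        (*-≈0 v (b ℤ.^ δ x y - 1ℤ) (≈-trans (≈-sym (pair-equation x∈X y∈X))
          (≈-trans (*-congˡ (a ℤ.^ x) e) (≈-reflexive (ℤ.*-zeroʳ (a ℤ.^ x))))))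

      δ≢h : ∀ {x y} → x ∈ X → y ∈ X → x ≢ y → δ x y ≢ h
      δ≢h {x} {y} x∈X y∈X x≢y δ≡h = powers-differ x∈X y∈X x≢y
        (subst (λ d → a ℤ.^ d - b ℤ.^ d ≈ 0ℤ) (sym δ≡h) (∣⇒≈0 (_≈_.∣-diff halves-agree)))

      -- For equal differences the two instances of `pair-equation` share the right side and the
      -- factor aᵟ - bᵟ. Cancelling that nonzero factor gives aˣ ≡ aˣ′, and multiplying by aᵟ gives
      -- aʸ ≡ aʸ′.
      δ-injective : ∀ {x y x′ y′} → x ∈ X → y ∈ X → x′ ∈ X → y′ ∈ X → x ≢ y →
        δ x y ≡ δ x′ y′ → x ≡ x′ × y ≡ y′
      δ-injective {x} {y} {x′} {y′} x∈X y∈X x′∈X y′∈X x≢y δ≡δ′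
        with bounds x∈X | bounds y∈X | bounds x′∈X | bounds y′∈X
      ... | 0<x , x≤n | 0<y , y≤n | 0<x′ , x′≤n | 0<y′ , y′≤n =
        order-injective oa 0<x x≤n 0<x′ x′≤n aˣ≈ ,
        order-injective oa 0<y y≤n 0<y′ y′≤n (begin
          a ℤ.^ y                        ≈⟨ ^-δ y oa x≤n ⟨
          a ℤ.^ x ℤ.* a ℤ.^ δ x y        ≈⟨ *-congʳ (a ℤ.^ δ x y) aˣ≈ ⟩
          a ℤ.^ x′ ℤ.* a ℤ.^ δ x y       ≡⟨ cong (λ d → a ℤ.^ x′ ℤ.* a ℤ.^ d) δ≡δ′ ⟩
          a ℤ.^ x′ ℤ.* a ℤ.^ δ x′ y′     ≈⟨ ^-δ y′ oa x′≤n ⟩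
          a ℤ.^ y′                       ∎)
        where
        open ≈-Reasoning
        aˣ≈ : a ℤ.^ x ≈ a ℤ.^ x′
        aˣ≈ = *-cancelʳ (a ℤ.^ δ x y - b ℤ.^ δ x y) (powers-differ x∈X y∈X x≢y)
          (≈-trans (pair-equation x∈X y∈X)
            (subst (λ d → v ℤ.* (b ℤ.^ d - 1ℤ) ≈ a ℤ.^ x′ ℤ.* (a ℤ.^ d - b ℤ.^ d)) (sym δ≡δ′)
              (≈-sym (pair-equation x′∈X y′∈X))))

    shifted-solutions : ¬ v ≈ 0ℤ → ∀ k → length X ≡ suc k → 2 + suc k * k ≤ n
    shifted-solutions v≉0 k eq = count X refl eq
      where
      δᶠ : ℕ → ℕ → Fin n
      δᶠ x y = fromℕ< (ℕ.m%n<n (y + n ∸ x) n)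
      -- The two residues 0 and n/2 that no difference of distinct solutions takes.
      z h′ : Fin n
      z = fromℕ< (order>0 oa)
      h′ = fromℕ< h<n
      -- Generalising the module parameter `X` to `Y` allows matching on a nonempty list.
      count : ∀ Y → Y ≡ X → length Y ≡ suc k → 2 + suc k * k ≤ n
      count (y ∷ ys) refl refl = ordered-pairs≤ X-unique δᶠ {z} {h′}
        (λ z≡h → ℕ.<⇒≢ 0<h (Fin.fromℕ<-injective _ _ (order>0 oa) h<n z≡h))
        (λ {x} {y} x∈ y∈ x≢y →
          (λ e → δ≢0 x∈ y∈ x≢y (Fin.fromℕ<-injective _ _ _ _ e)) ,
          (λ e → δ≢h v≉0 x∈ y∈ x≢y (Fin.fromℕ<-injective _ _ _ _ e)))
        (λ x∈ y∈ x′∈ y′∈ x≢y _ e → δ-injective v≉0 x∈ y∈ x′∈ y′∈ x≢y (Fin.fromℕ<-injective _ _ _ _ e))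

    module _ (v≈0 : v ≈ 0ℤ) (a≉b : ¬ a ≈ b) {t m : ℕ} (0<t : 0 < t) (n≡mt : n ≡ m * t)
      (t-least : ∀ q → Prime q → q ∣ h → t ≤ q) where

      -- A common divisor above 1 has a prime factor; dividing `h`, it is at least `t`, but it also
      -- divides d < t.
      below-t-coprime : ∀ {d} → 0 < d → d < t → Coprime d h
      below-t-coprime {d} 0<d d<t {zero} (0∣d , _) = contradiction (ℕ.0∣⇒≡0 0∣d) (ℕ.n>0⇒n≢0 0<d)
      below-t-coprime {d} 0<d d<t {suc zero} _ = refl
      below-t-coprime {d} 0<d d<t {g@(suc (suc _))} (g∣d , g∣h) with prime-divisor g (s≤s z<s)
      ... | q , q-prime , q∣g = contradiction (t-least q q-prime (ℕ.∣-trans q∣g g∣h))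
        (ℕ.<⇒≱ (ℕ.≤-<-trans (ℕ.∣⇒≤ {{>-nonZero 0<d}} (ℕ.∣-trans q∣g g∣d)) d<t))

      -- As `v` vanishes, comparing the congruences at x + d and at `x` eliminates `c`.
      powers-agree : ∀ {x} d → x ∈ X → x + d ∈ X → a ℤ.^ d ≈ b ℤ.^ d
      powers-agree {x} d x∈X x+d∈X = *-cancelˡ (a ℤ.^ x) (^-≉0 x (order⇒≉0 oa)) (begin
        a ℤ.^ x ℤ.* a ℤ.^ d            ≡⟨ ℤ.^-distribˡ-+-* a x d ⟨
        a ℤ.^ (x + d)                  ≈⟨ unshifted x+d∈X ⟩
        c ℤ.* b ℤ.^ (x + d)            ≡⟨ cong (c ℤ.*_) (ℤ.^-distribˡ-+-* b x d) ⟩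
        c ℤ.* (b ℤ.^ x ℤ.* b ℤ.^ d)    ≡⟨ ℤ.*-assoc c _ _ ⟨
        c ℤ.* b ℤ.^ x ℤ.* b ℤ.^ d      ≈⟨ *-congʳ (b ℤ.^ d) (unshifted x∈X) ⟨
        a ℤ.^ x ℤ.* b ℤ.^ d            ∎)
        where
        open ≈-Reasoning
        unshifted : ∀ {x} → x ∈ X → a ℤ.^ x ≈ c ℤ.* b ℤ.^ x
        unshifted {x} x∈X = ≈-trans (≈-reflexive (sym (ℤ.+-identityʳ _)))
          (≈-trans (+-cong (≈-refl {a ℤ.^ x}) (≈-sym v≈0)) (solution x∈X))

      powers-agree-* : ∀ {d} k → a ℤ.^ d ≈ b ℤ.^ d → a ℤ.^ (k * d) ≈ b ℤ.^ (k * d)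
      powers-agree-* {d} k e = begin
        a ℤ.^ (k * d)       ≡⟨ cong (a ℤ.^_) (ℕ.*-comm k d) ⟩
        a ℤ.^ (d * k)       ≡⟨ ℤ.^-*-assoc a d k ⟨
        (a ℤ.^ d) ℤ.^ k     ≈⟨ ^-cong k e ⟩
        (b ℤ.^ d) ℤ.^ k     ≡⟨ ℤ.^-*-assoc b d k ⟩
        b ℤ.^ (d * k)       ≡⟨ cong (b ℤ.^_) (ℕ.*-comm d k) ⟩
        b ℤ.^ (k * d)       ∎
        where open ≈-Reasoning

      consecutive-powers-agree : ∀ {i j} → suc i ≡ j → a ℤ.^ i ≈ b ℤ.^ i → a ℤ.^ j ≈ b ℤ.^ j → a ≈ b
      consecutive-powers-agree {i} refl eᵢ eⱼ = *-cancelʳ (a ℤ.^ i) (^-≉0 i (order⇒≉0 oa))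
        (≈-trans eⱼ (*-congˡ b (≈-sym eᵢ)))

      -- Bézout yields a multiple of `d` and a multiple of `h` that differ by 1. The powers of `a`
      -- and `b` agree at both exponents, and cancelling would give a ≡ b.
      ¬close : ∀ {x d} → 0 < d → d < t → x ∈ X → ¬ x + d ∈ X
      ¬close {x} {d} 0<d d<t x∈X x+d∈X with coprime-Bézout (below-t-coprime 0<d d<t)
      ... | Bézout.+- i j eq = a≉b
        (consecutive-powers-agree eq (powers-agree-* j halves-agree) (powers-agree-* i (powers-agree d x∈X x+d∈X)))
      ... | Bézout.-+ i j eq = a≉b
        (consecutive-powers-agree eq (powers-agree-* i (powers-agree d x∈X x+d∈X)) (powers-agree-* j halves-agree))

      -- The range 1, ..., n splits into `m` blocks of `t` consecutive numbers, and by `¬close` no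
      -- block contains two solutions.
      unshifted-solutions : length X ≤ m
      unshifted-solutions = length≤ X-unique block block< block-inj
        where
        instance
          t≢0 : NonZero t
          t≢0 = >-nonZero 0<t
        -- Solutions are numbered from 1, hence the predecessor before dividing.
        block : ℕ → ℕ
        block x = ℕ.pred x / t
        block< : ∀ {x} → x ∈ X → block x < m
        block< {zero}  x∈X = contradiction (proj₁ (bounds x∈X)) λ ()
        block< {suc x} x∈X = ℕ.m<n*o⇒m/o<n (subst (x <_) n≡mt (proj₂ (bounds x∈X)))
        blocks-differ : ∀ {x y} → x < y → x ∈ X → y ∈ X → block x ≢ block y
        blocks-differ {zero}          _         x∈X _   _  = contradiction (proj₁ (bounds x∈X)) λ ()
        blocks-differ {suc x} {suc y} (s≤s x<y) x∈X y∈X eq = ¬close (ℕ.m<n⇒0<n∸m x<y) gap<t x∈X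
          (subst (_∈ X) (cong suc (sym (ℕ.m+[n∸m]≡n (ℕ.<⇒≤ x<y)))) y∈X)
          where
          quotient-remainder : ∀ z → z ≡ z / t * t + z % t
          quotient-remainder z = trans (ℕ.m≡m%n+[m/n]*n z t) (ℕ.+-comm (z % t) _)
          gap<t : y ∸ x < t
          gap<t = ℕ.≤-<-trans (begin
            y ∸ x                                      ≡⟨ cong₂ _∸_ (quotient-remainder y) (quotient-remainder x) ⟩
            (y / t * t + y % t) ∸ (x / t * t + x % t)  ≡⟨ cong (λ k → (k * t + y % t) ∸ (x / t * t + x % t)) (sym eq) ⟩
            (x / t * t + y % t) ∸ (x / t * t + x % t)  ≡⟨ ℕ.[m+n]∸[m+o]≡n∸o (x / t * t) (y % t) (x % t) ⟩
            y % t ∸ x % t                              ≤⟨ ℕ.m∸n≤m (y % t) (x % t) ⟩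
            y % t                                      ∎) (ℕ.m%n<n y t)
            where open ℕ.≤-Reasoning
        block-inj : ∀ {x y} → x ∈ X → y ∈ X → block x ≡ block y → x ≡ y
        block-inj {x} {y} x∈X y∈X eq with ℕ.<-cmp x y
        ... | tri< x<y _ _ = contradiction eq (blocks-differ x<y x∈X y∈X)
        ... | tri≈ _ x≡y _ = x≡y
        ... | tri> _ _ x>y = contradiction (sym eq) (blocks-differ x>y y∈X x∈X)

-- List maxima, ranges, the floor and the parity of p - 1.

maxList≤ : ∀ {xs B} → (∀ {x} → x ∈ xs → x ≤ B) → maxList xs ≤ B
maxList≤ {[]}     bound = z≤n
maxList≤ {x ∷ xs} bound = ℕ.⊔-lub (bound (here refl)) (maxList≤ (bound ∘ there))

≤maxList : ∀ {xs x} → x ∈ xs → x ≤ maxList xs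
≤maxList {x ∷ xs} (here refl) = ℕ.m≤m⊔n x (maxList xs)
≤maxList {x ∷ xs} (there x∈)  = ℕ.≤-trans (≤maxList x∈) (ℕ.m≤n⊔m x (maxList xs))

∈-range⁻ : ∀ n {x} → x ∈ rangeℕ 1 n → 0 < x × x ≤ n
∈-range⁻ n x∈ with ∈-map⁻ suc x∈
... | i , i∈ , refl = z<s , ∈-upTo⁻ i∈

∈-range⁺ : ∀ {n x} → 0 < x → x ≤ n → x ∈ rangeℕ 1 n
∈-range⁺ {x = suc i} _ i<n = ∈-map⁺ suc (∈-upTo⁺ i<n)

range-unique : ∀ n → Unique (rangeℕ 1 n)
range-unique n = Unique.map⁺ ℕ.suc-injective (Unique.upTo⁺ n)

≤length : ∀ {A : Set} {xs : List A} {m} (f : Fin m → A) →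
  (∀ {i j} → f i ≡ f j → i ≡ j) → (∀ i → f i ∈ xs) → m ≤ length xs
≤length {xs = xs} f f-inj f∈ = Fin.injective⇒≤ {f = λ i → Any.index (f∈ i)} λ {i} {j} eq →
  f-inj (trans (Any.lookup-index (f∈ i)) (trans (cong (lookup xs) eq) (sym (Any.lookup-index (f∈ j)))))

-- The search descends from `b` and stops at its first success, so it never passes below a candidate
-- that succeeds.
≤welchFloorSearch : ∀ p b k → k ≤ b → (k * (p ∸ 1)) ^ 2 ≤ (p ∸ 3) ^ 2 * p → k ≤ welchFloorSearch p b
≤welchFloorSearch p zero    k k≤b le = k≤b
≤welchFloorSearch p (suc b) k k≤b le with (suc b * (p ∸ 1)) ^ 2 ℕ.≤? (p ∸ 3) ^ 2 * p
... | yes _ = k≤b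
... | no ≰ with ℕ.m≤n⇒m<n∨m≡n k≤b
...   | inj₁ (s≤s k≤b′) = ≤welchFloorSearch p b k k≤b′ le
...   | inj₂ refl       = contradiction le ≰

-- For n = k² + 3 + o, the difference (n - 2)² (n + 1) - (k n)² is a polynomial in `k` and `o` with
-- nonnegative coefficients, spelled out in `lemma`; at o = 0 it equals 4.
≤welchFloor : ∀ n k → k * k + 3 ≤ n → k ≤ welchFloor (suc n)
≤welchFloor n k le with ℕ.m≤n⇒∃[o]m+o≡n le
... | o , refl = ≤welchFloorSearch (suc n) (suc n) k (k≤n k le) (begin
  (k * n) ^ 2                ≡⟨ square (k * n) ⟩
  k * n * (k * n)            ≤⟨ ℕ.m≤m+n _ _ ⟩
  k * n * (k * n) + _        ≡⟨ lemma k o ⟩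
  n-2 * n-2 * suc n          ≡⟨ cong (λ z → z * z * suc n) (cong (_∸ 2) (lemma′ (k * k) o)) ⟨
  (n ∸ 2) * (n ∸ 2) * suc n  ≡⟨ cong (_* suc n) (square (n ∸ 2)) ⟨
  (n ∸ 2) ^ 2 * suc n        ∎)
  where
  open ℕ.≤-Reasoning
  n-2 = k * k + 1 + o
  square : ∀ m → m ^ 2 ≡ m * m
  square m = cong (m *_) (ℕ.*-identityʳ m)
  k≤n : ∀ k → k * k + 3 ≤ n → k ≤ suc n
  k≤n zero      _  = z≤n
  k≤n k@(suc _) le = ℕ.≤-trans (ℕ.m≤m*n k k) (ℕ.m≤n⇒m≤1+n (ℕ.≤-trans (ℕ.m≤m+n (k * k) 3) le))
  lemma : ∀ k o → k * (k * k + 3 + o) * (k * (k * k + 3 + o)) +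
    (4 + (k * k + 3) * (k * k + 3) * o + 2 * (k * k + 3) * (o * o) + o * o * o) ≡
    (k * k + 1 + o) * (k * k + 1 + o) * suc (k * k + 3 + o)
  lemma = ℕ-Solver.solve-∀
  lemma′ : ∀ s o → s + 3 + o ≡ 2 + (s + 1 + o)
  lemma′ = ℕ-Solver.solve-∀

-- For odd `n` the prime n + 1 would be even, hence 2, against 2 ≤ n.
prime-even : ∀ n → Prime (suc n) → 2 ≤ n → n ≡ n / 2 + n / 2
prime-even n p-prime 2≤n = trans (ℕ.m≡m%n+[m/n]*n n 2)
  (trans (cong (_+ n / 2 * 2) n%2≡0) (lemma (n / 2)))
  where
  lemma : ∀ h → h * 2 ≡ h + h
  lemma = ℕ-Solver.solve-∀
  lemma′ : ∀ h → suc (1 + h * 2) ≡ suc h * 2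
  lemma′ = ℕ-Solver.solve-∀
  n%2≡0 : n % 2 ≡ 0
  n%2≡0 with n % 2 in eq | ℕ.m%n<n n 2
  ... | 0 | _ = refl
  ... | 1 | _ with prime⇒irreducible p-prime (divides (suc (n / 2))
                     (trans (cong suc (trans (ℕ.m≡m%n+[m/n]*n n 2) (cong (_+ n / 2 * 2) eq))) (lemma′ (n / 2))))
  ...   | inj₂ 2≡1+n = contradiction 2≡1+n (ℕ.<⇒≢ (s≤s 2≤n))
  n%2≡0 | suc (suc _) | s≤s (s≤s ())

-- Primitive roots and the maximum over the Welch family.

module WelchFamily (n : ℕ) (p-prime : Prime (suc n)) (4≤n : 4 ≤ n) where

  open PrimeModulus n p-prime
  open MultiplicativeOrder n p-prime
  open PrimitiveElements n p-prime
  open Solutions n p-prime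

  h : ℕ
  h = n / 2

  n≡h+h : n ≡ h + h
  n≡h+h = prime-even n p-prime (ℕ.≤-trans (s≤s (s≤s z≤n)) 4≤n)

  -- The order is at most `n`, and an order below `n` would be one of the exponents that the
  -- definition excludes.
  ∈-primitiveRoots⁻ : ∀ {g} → g ∈ primitiveRoots p → g < p × Order (+ g) n
  ∈-primitiveRoots⁻ {g} g∈ with ∈-filter⁻ (isPrimitiveRoot? p) g∈
  ... | g∈range , g-primitive with ∈-range⁻ n g∈range
  ...   | 0<g , g≤n with order-exists (pos-≉0 0<g (s≤s g≤n))
  ...     | e , s≤s e≤n , o with ℕ.m≤n⇒m<n∨m≡n e≤n
  ...       | inj₂ refl = s≤s g≤n , o
  ...       | inj₁ e<n  = contradiction
    (<p⇒≡ (ℕ.m%n<n (g ^ e) p) (s≤s (ℕ.≤-trans (s≤s z≤n) 4≤n)) (≈-trans (pos-^-% g e) (^-order o)))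
    (All.lookup g-primitive (∈-range⁺ (order>0 o) (ℕ.<⇒≤pred e<n)))

  ∈-primitiveRoots⁺ : ∀ {g} → g < p → Order (+ g) n → g ∈ primitiveRoots p
  ∈-primitiveRoots⁺ {g} (s≤s g≤n) o = ∈-filter⁺ (isPrimitiveRoot? p)
    (∈-range⁺ (ℕ.n≢0⇒n>0 λ { refl → order⇒≉0 o ≈-refl }) g≤n)
    (All.tabulate λ {k} k∈ gᵏ≡1 → let (0<k , k≤n-1) = ∈-range⁻ (n ∸ 1) k∈ in
      ℕ.>⇒∤ {{>-nonZero 0<k}} (ℕ.m≤pred[n]⇒suc[m]≤n {{>-nonZero (order>0 o)}} k≤n-1)
        (minimal o k (≈-trans (≈-sym (pos-^-% g k)) (≈-reflexive (cong +_ gᵏ≡1)))))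

  -- Orders depend only on the residue class, so a generator can be replaced by its remainder modulo
  -- `p`.
  primitiveRoot : ∀ {a} → Order a n → ∃[ g ] g ∈ primitiveRoots p × + g ≈ a
  primitiveRoot {a} o = a ℤ.%ℕ p , ∈-primitiveRoots⁺ (ℤ.n%ℕd<d a p) (order-resp-≈ (≈-sym (%ℕ-≈ a)) o) , %ℕ-≈ a
    where
    order-resp-≈ : ∀ {a b e} → a ≈ b → Order a e → Order b e
    order-resp-≈ {e = e} a≈b o = record
      { order>0 = order>0 o
      ; ^-order = ≈-trans (^-cong e (≈-sym a≈b)) (^-order o)
      ; minimal = λ k eq → minimal o k (≈-trans (^-cong k a≈b) eq)
      }

  distinctPairs : List (ℕ × ℕ)
  distinctPairs = filter (λ (g₁ , g₂) → ¬? (g₁ ℕ.≟ g₂)) (cartesianProduct (primitiveRoots p) (primitiveRoots p))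

  welchCorrelation : ℕ → ℕ → ℤ → ℤ → ℕ
  welchCorrelation g₁ g₂ = crossCorrelation n (welchPerm p g₁) (welchPerm p g₂)

  correlations : ℕ × ℕ → List ℕ
  correlations (g₁ , g₂) = concatMap (λ u → map (welchCorrelation g₁ g₂ u) (shifts n)) (shifts n)

  -- The shift enters as u = k - (n - 1) with natural `k`, so that bᵘ can later be replaced by the
  -- natural power bᵏ⁺¹.
  maxCrossCorrelation≤ : ∀ {B} →
    (∀ {g₁ g₂ k} v → g₁ ∈ primitiveRoots p → g₂ ∈ primitiveRoots p → g₁ ≢ g₂ →
      welchCorrelation g₁ g₂ (+ k - + (n ∸ 1)) v ≤ B) →
    maxCrossCorrelationWelch p ≤ B
  maxCrossCorrelation≤ {B} bound = maxList≤ {concatMap correlations distinctPairs} below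
    where
    below : ∀ {x} → x ∈ concatMap correlations distinctPairs → x ≤ B
    below x∈ with find (∈-concatMap⁻ correlations {distinctPairs} x∈)
    ... | (g₁ , g₂) , g∈ , x∈g
      with ∈-filter⁻ (λ (g₁ , g₂) → ¬? (g₁ ℕ.≟ g₂)) g∈
         | find (∈-concatMap⁻ (λ u → map (welchCorrelation g₁ g₂ u) (shifts n)) {shifts n} x∈g)
    ...   | g∈′ , g₁≢g₂ | u , u∈ , x∈u
      with ∈-cartesianProduct⁻ (primitiveRoots p) (primitiveRoots p) g∈′
         | ∈-map⁻ (λ k → + k - + (n ∸ 1)) {xs = upTo (n + n ∸ 1)} u∈
         | ∈-map⁻ (welchCorrelation g₁ g₂ u) {xs = shifts n} x∈u
    ...     | g₁∈ , g₂∈ | k , _ , refl | v , _ , refl = bound v g₁∈ g₂∈ g₁≢g₂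

  0∈shifts : 0ℤ ∈ shifts n
  0∈shifts = subst (_∈ shifts n) (ℤ.+-inverseʳ (+ (n ∸ 1))) (∈-map⁺ (λ k → + k - + (n ∸ 1)) (∈-upTo⁺ n-1<2n-1))
    where
    n-1<2n-1 : n ∸ 1 < n + n ∸ 1
    n-1<2n-1 = ℕ.∸-monoˡ-< (ℕ.m<m+n n (ℕ.<-≤-trans z<s 4≤n)) (ℕ.≤-trans (s≤s z≤n) 4≤n)

  ≤maxCrossCorrelation : ∀ {g₁ g₂} → g₁ ∈ primitiveRoots p → g₂ ∈ primitiveRoots p → g₁ ≢ g₂ →
    welchCorrelation g₁ g₂ 0ℤ 0ℤ ≤ maxCrossCorrelationWelch p
  ≤maxCrossCorrelation {g₁} {g₂} g₁∈ g₂∈ g₁≢g₂ = ≤maxList {concatMap correlations distinctPairs}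
    (∈-concatMap⁺ correlations (lose
      (∈-filter⁺ (λ (g₁ , g₂) → ¬? (g₁ ℕ.≟ g₂)) (∈-cartesianProduct⁺ g₁∈ g₂∈) g₁≢g₂)
      (∈-concatMap⁺ (λ u → map (welchCorrelation g₁ g₂ u) (shifts n))
        (lose 0∈shifts (∈-map⁺ (welchCorrelation g₁ g₂ 0ℤ) 0∈shifts)))))

-- Bounds for the correlations and a pair attaining the maximum.

module WelchCorrelation (n : ℕ) (p-prime : Prime (suc n)) (4≤n : 4 ≤ n) where

  open PrimeModulus n p-prime
  open MultiplicativeOrder n p-prime
  open Solutions n p-prime
  open WelchFamily n p-prime 4≤n

  -- `Match` and `match?` copy the test local to `crossCorrelation`, so a correlation value is by
  -- definition the length of `matches`.
  Match : ℕ → ℕ → ℤ → ℤ → ℕ → Set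
  Match g₁ g₂ u v x = (+ 1 ℤ.≤ + x ℤ.+ u × + x ℤ.+ u ℤ.≤ + n)
                      × + welchPerm p g₁ x ℤ.+ v ≡ + welchPerm p g₂ ℤ.∣ + x ℤ.+ u ∣

  match? : ∀ g₁ g₂ u v → Decidable (Match g₁ g₂ u v)
  match? g₁ g₂ u v x = ((+ 1 ℤ.≤? + x ℤ.+ u) ×-dec (+ x ℤ.+ u ℤ.≤? + n))
                       ×-dec (+ welchPerm p g₁ x ℤ.+ v ℤ.≟ + welchPerm p g₂ ℤ.∣ + x ℤ.+ u ∣)

  matches : ℕ → ℕ → ℤ → ℤ → List ℕ
  matches g₁ g₂ u v = filter (match? g₁ g₂ u v) (rangeℕ 1 n)

  -- Here x + u + n = k + 1 + x, and adding the period `n` leaves the power of `g₂` unchanged.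
  -- Positivity of x + u removes the absolute value.
  match⇒solution : ∀ {g₁ g₂ k v x} → Order (+ g₂) n → Match g₁ g₂ (+ k - + (n ∸ 1)) v x →
    (+ g₁) ℤ.^ x ℤ.+ v ≈ (+ g₂) ℤ.^ suc k ℤ.* (+ g₂) ℤ.^ x
  match⇒solution {g₁} {g₂} {k} {v} {x} o ((1≤x+u , _) , eq) = begin
    a ℤ.^ x ℤ.+ v                      ≈⟨ +-cong (pos-^-% g₁ x) (≈-refl {v}) ⟨
    + welchPerm p g₁ x ℤ.+ v           ≡⟨ eq ⟩
    + welchPerm p g₂ w                 ≈⟨ pos-^-% g₂ w ⟩
    b ℤ.^ w                            ≡⟨ ℤ.*-identityʳ _ ⟨
    b ℤ.^ w ℤ.* 1ℤ                     ≈⟨ *-congˡ (b ℤ.^ w) (^-order o) ⟨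
    b ℤ.^ w ℤ.* b ℤ.^ n                ≡⟨ ℤ.^-distribˡ-+-* b w n ⟨
    b ℤ.^ (w + n)                      ≡⟨ cong (b ℤ.^_) (ℤ.+-injective w+n≡) ⟩
    b ℤ.^ (suc k + x)                  ≡⟨ ℤ.^-distribˡ-+-* b (suc k) x ⟩
    b ℤ.^ suc k ℤ.* b ℤ.^ x            ∎
    where
    open ≈-Reasoning
    a = + g₁
    b = + g₂
    u = + k - + (n ∸ 1)
    w = ℤ.∣ + x ℤ.+ u ∣
    n≡1+ : n ≡ 1 + (n ∸ 1)
    n≡1+ = sym (ℕ.m+[n∸m]≡n (ℕ.≤-trans (s≤s z≤n) 4≤n))
    lemma : ∀ x k m → (x ℤ.+ (k - m)) ℤ.+ (1ℤ ℤ.+ m) ≡ 1ℤ ℤ.+ k ℤ.+ x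
    lemma = solve-∀
    w+n≡ : + (w + n) ≡ + (suc k + x)
    w+n≡ = trans (cong (λ z → + (w + z)) n≡1+)
      (trans (cong (ℤ._+ + (1 + (n ∸ 1))) (ℤ.0≤i⇒+∣i∣≡i (ℤ.≤-trans (ℤ.+≤+ z≤n) 1≤x+u)))
        (lemma (+ x) (+ k) (+ (n ∸ 1))))

  module _ {g₁ g₂ k : ℕ} (v : ℤ)
    (g₁∈ : g₁ ∈ primitiveRoots p) (g₂∈ : g₂ ∈ primitiveRoots p) (g₁≢g₂ : g₁ ≢ g₂) where

    private
      N = welchCorrelation g₁ g₂ (+ k - + (n ∸ 1)) v
      X = matches g₁ g₂ (+ k - + (n ∸ 1)) v
      g₁<p = proj₁ (∈-primitiveRoots⁻ g₁∈)
      g₂<p = proj₁ (∈-primitiveRoots⁻ g₂∈)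
      o₁ = proj₂ (∈-primitiveRoots⁻ g₁∈)
      o₂ = proj₂ (∈-primitiveRoots⁻ g₂∈)
      X-unique : Unique X
      X-unique = Unique.filter⁺ (match? g₁ g₂ (+ k - + (n ∸ 1)) v) (range-unique n)
      bounds : ∀ {x} → x ∈ X → 0 < x × x ≤ n
      bounds x∈X = ∈-range⁻ n (proj₁ (∈-filter⁻ (match? g₁ g₂ (+ k - + (n ∸ 1)) v) {xs = rangeℕ 1 n} x∈X))
      solution : ∀ {x} → x ∈ X → (+ g₁) ℤ.^ x ℤ.+ v ≈ (+ g₂) ℤ.^ suc k ℤ.* (+ g₂) ℤ.^ x
      solution x∈X = match⇒solution o₂ (proj₂ (∈-filter⁻ (match? g₁ g₂ (+ k - + (n ∸ 1)) v) {xs = rangeℕ 1 n} x∈X))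

    welchCorrelation-shifted : ¬ v ≈ 0ℤ → ∀ {i} → N ≡ suc i → 2 + suc i * i ≤ n
    welchCorrelation-shifted v≉0 {i} =
      shifted-solutions o₁ o₂ {h} n≡h+h ((+ g₂) ℤ.^ suc k) v X-unique bounds solution v≉0 i

    welchCorrelation-unshifted : v ≈ 0ℤ → ∀ {t m} → 0 < t → n ≡ m * t →
      (∀ q → Prime q → q ∣ h → t ≤ q) → N ≤ m
    welchCorrelation-unshifted v≈0 0<t = unshifted-solutions o₁ o₂ {h} n≡h+h ((+ g₂) ℤ.^ suc k) v
      X-unique bounds solution v≈0 (g₁≢g₂ ∘ <p⇒≡ g₁<p g₂<p) 0<t

  -- For v ≡ 0, taking t = h allows at most n / h = 2 solutions, within the bound as the floor is at
  -- least 1. For v ≢ 0 the pair count is compared with the floor.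
  safe-prime-bound : Prime h → maxCrossCorrelationWelch p ≤ 1 + welchFloor p
  safe-prime-bound h-prime = maxCrossCorrelation≤ bound
    where
    n≡2h : n ≡ 2 * h
    n≡2h = trans n≡h+h (cong (_+_ h) (sym (ℕ.+-identityʳ h)))
    h-least : ∀ q → Prime q → q ∣ h → h ≤ q
    h-least q q-prime q∣h with prime⇒irreducible h-prime q∣h
    ... | inj₁ refl = contradiction (nonTrivial⇒n>1 1 {{prime⇒nonTrivial q-prime}}) (ℕ.n≮n 1)
    ... | inj₂ refl = ℕ.≤-refl
    1≤floor : 1 ≤ welchFloor p
    1≤floor = ≤welchFloor n 1 4≤n
    from-pairs : ∀ N → (∀ {i} → N ≡ suc i → 2 + suc i * i ≤ n) → N ≤ 1 + welchFloor p
    from-pairs zero          _     = z≤n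
    from-pairs (suc zero)    _     = s≤s z≤n
    -- With N = i + 2, the pair count N (N - 1) + 2 equals (i + 1)² + 3 + i, so `≤welchFloor`
    -- applies to i + 1.
    from-pairs (suc (suc i)) pairs = s≤s (≤welchFloor n (suc i) (ℕ.≤-trans
      (ℕ.≤-trans (ℕ.m≤m+n _ i) (ℕ.≤-reflexive (lemma i))) (pairs refl)))
      where
      lemma : ∀ i → suc i * suc i + 3 + i ≡ 2 + suc (suc i) * suc i
      lemma = ℕ-Solver.solve-∀
    bound : ∀ {g₁ g₂ k} v → g₁ ∈ primitiveRoots p → g₂ ∈ primitiveRoots p → g₁ ≢ g₂ →
      welchCorrelation g₁ g₂ (+ k - + (n ∸ 1)) v ≤ 1 + welchFloor p
    bound {g₁} {g₂} {k} v g₁∈ g₂∈ g₁≢g₂ with v ≈? 0ℤ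
    ... | yes v≈0 = ℕ.≤-trans
      (welchCorrelation-unshifted {k = k} v g₁∈ g₂∈ g₁≢g₂ v≈0 (>-nonZero⁻¹ h {{prime⇒nonZero h-prime}}) n≡2h h-least)
      (s≤s 1≤floor)
    ... | no v≉0 = from-pairs _ (welchCorrelation-shifted {k = k} v g₁∈ g₂∈ g₁≢g₂ v≉0)

  module NonSafe {t s : ℕ} (t-prime : Prime t) (h≡st : h ≡ s * t) (t≤s : t ≤ s)
    (t-least : ∀ q → Prime q → q ∣ h → t ≤ q) where

    private
      1<t : 1 < t
      1<t = nonTrivial⇒n>1 t {{prime⇒nonTrivial t-prime}}
      0<t : 0 < t
      0<t = ℕ.<-trans z<s 1<t
      m = 2 * s
      0<m : 0 < m
      0<m = ℕ.*-mono-≤ {1} {2} (s≤s z≤n) (ℕ.≤-trans 0<t t≤s)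
      n≡mt : n ≡ m * t
      n≡mt = trans n≡h+h (trans (cong (λ z → z + z) h≡st) (lemma s t))
        where
        lemma : ∀ s t → s * t + s * t ≡ 2 * s * t
        lemma = ℕ-Solver.solve-∀

    -- For v ≢ 0, a value N > m would give N (N - 1) ≥ m² ≥ m t = n, against N (N - 1) + 2 ≤ n; t ≤
    -- m comes from t ≤ s.
    upper : maxCrossCorrelationWelch p ≤ m
    upper = maxCrossCorrelation≤ bound
      where
      from-pairs : ∀ N → (∀ {i} → N ≡ suc i → 2 + suc i * i ≤ n) → N ≤ m
      from-pairs zero    _     = z≤n
      from-pairs (suc i) pairs = ℕ.≰⇒> λ m≤i → ℕ.<⇒≱ (begin-strict
        n                 ≡⟨ n≡mt ⟩
        m * t             ≤⟨ ℕ.*-monoʳ-≤ m (ℕ.≤-trans t≤s (ℕ.m≤m+n s _)) ⟩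
        m * m             ≤⟨ ℕ.*-mono-≤ (ℕ.m≤n⇒m≤1+n m≤i) m≤i ⟩
        suc i * i         <⟨ ℕ.m<n+m (suc i * i) {2} z<s ⟩
        2 + suc i * i     ∎) (pairs refl)
        where open ℕ.≤-Reasoning
      bound : ∀ {g₁ g₂ k} v → g₁ ∈ primitiveRoots p → g₂ ∈ primitiveRoots p → g₁ ≢ g₂ →
        welchCorrelation g₁ g₂ (+ k - + (n ∸ 1)) v ≤ m
      bound {g₁} {g₂} {k} v g₁∈ g₂∈ g₁≢g₂ with v ≈? 0ℤ
      ... | yes v≈0 = welchCorrelation-unshifted {k = k} v g₁∈ g₂∈ g₁≢g₂ v≈0 0<t n≡mt t-least
      ... | no v≉0  = from-pairs _ (welchCorrelation-shifted {k = k} v g₁∈ g₂∈ g₁≢g₂ v≉0)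

    -- Makes 1 + j m coprime to n = m t, as it is coprime to `m` for every `j`. If `t` divided both
    -- 1 + m and 1 + 2m, it would divide 2 (1 + m) - (1 + 2m) = 1.
    multiplier : ∃[ j ] 0 < j × j < t × ¬ t ∣ 1 + j * m
    multiplier with t ℕ.∣? 1 + 1 * m
    ... | no t∤ = 1 , z<s , 1<t , t∤
    ... | yes t∣1+m = 2 , z<s , ℕ.≤∧≢⇒< 1<t 2≢t , λ t∣1+2m → t∤1 (ℕ.∣m+n∣m⇒∣n
      (subst (t ∣_) (lemma m) (ℕ.∣m⇒∣m*n 2 t∣1+m)) t∣1+2m)
      where
      lemma : ∀ m → (1 + 1 * m) * 2 ≡ (1 + 2 * m) + 1
      lemma = ℕ-Solver.solve-∀
      t∤1 : ¬ t ∣ 1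
      t∤1 t∣1 = ℕ.<⇒≱ 1<t (ℕ.∣⇒≤ t∣1)
      -- For t = 2, m = 2s is even and `t` could not divide 1 + m.
      2≢t : 2 ≢ t
      2≢t refl = t∤1 (ℕ.∣m+n∣m⇒∣n (subst (t ∣_) (ℕ.+-comm 1 (1 * m)) t∣1+m) (ℕ.∣n⇒∣m*n 1 (ℕ.m∣m*n s)))

    lower : m ≤ maxCrossCorrelationWelch p
    lower with generator | multiplier
    ... | a , o | j , 0<j , j<t , t∤r
      with primitiveRoot o | primitiveRoot (order-coprime-^ (1 + j * m) o n⊥r)
      where
      m⊥r : Coprime m (1 + j * m)
      m⊥r {d} (d∣m , d∣r) = ℕ.∣1⇒≡1 (ℕ.∣m+n∣m⇒∣n (subst (d ∣_) (ℕ.+-comm 1 (j * m)) d∣r) (ℕ.∣n⇒∣m*n j d∣m))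
      n⊥r : Coprime n (1 + j * m)
      n⊥r = subst (λ z → Coprime z (1 + j * m)) (sym n≡mt) (coprime-* m⊥r (prime-coprime t-prime t∤r))
    ... | g₁ , g₁∈ , g₁≈a | g₂ , g₂∈ , g₂≈aʳ = ℕ.≤-trans
      (≤length {xs = matches g₁ g₂ 0ℤ 0ℤ} x x-injective x∈matches)
      (≤maxCrossCorrelation g₁∈ g₂∈ g₁≢g₂)
      where
      r = 1 + j * m
      -- Equality would give a ≡ aʳ, so a^(j m) ≡ 1 with 0 < j m < t m = n.
      g₁≢g₂ : g₁ ≢ g₂
      g₁≢g₂ refl = ℕ.>⇒∤ {{>-nonZero (ℕ.*-mono-≤ 0<j 0<m)}} jm<n
        (minimal o (j * m) (^-∸ {i = 1} {r} (order⇒≉0 o) (s≤s z≤n)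
          (≈-trans (≈-reflexive (ℤ.^-identityʳ a)) (≈-trans (≈-sym g₁≈a) g₂≈aʳ))))
        where
        jm<n : j * m < n
        jm<n = subst (j * m <_) (trans (ℕ.*-comm t m) (sym n≡mt)) (ℕ.*-monoˡ-< m {{>-nonZero 0<m}} j<t)
      x : Fin m → ℕ
      x i = suc (toℕ i) * t
      x-injective : ∀ {i i′} → x i ≡ x i′ → i ≡ i′
      x-injective eq = Fin.toℕ-injective (ℕ.suc-injective (ℕ.*-cancelʳ-≡ _ _ t {{>-nonZero 0<t}} eq))
      x∈range : ∀ i → 0 < x i × x i ≤ n
      x∈range i = ℕ.*-mono-≤ {1} {suc (toℕ i)} (s≤s z≤n) 0<t , subst (x i ≤_) (sym n≡mt) (ℕ.*-monoˡ-≤ t (Fin.toℕ<n i))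
      same-value : ∀ i → welchPerm p g₁ (x i) ≡ welchPerm p g₂ (x i)
      same-value i = <p⇒≡ (ℕ.m%n<n (g₁ ^ x i) p) (ℕ.m%n<n (g₂ ^ x i) p) (begin
        + welchPerm p g₁ (x i)              ≈⟨ pos-^-% g₁ (x i) ⟩
        (+ g₁) ℤ.^ x i                      ≈⟨ ^-cong (x i) g₁≈a ⟩
        a ℤ.^ x i                           ≡⟨ ℤ.*-identityʳ _ ⟨
        a ℤ.^ x i ℤ.* 1ℤ                    ≈⟨ *-congˡ (a ℤ.^ x i) (^-multiple o n∣jmx) ⟨
        a ℤ.^ x i ℤ.* a ℤ.^ (j * m * x i)   ≡⟨ ℤ.^-distribˡ-+-* a (x i) (j * m * x i) ⟨
        a ℤ.^ (r * x i)                     ≡⟨ ℤ.^-*-assoc a r (x i) ⟨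
        (a ℤ.^ r) ℤ.^ x i                   ≈⟨ ^-cong (x i) g₂≈aʳ ⟨
        (+ g₂) ℤ.^ x i                      ≈⟨ pos-^-% g₂ (x i) ⟨
        + welchPerm p g₂ (x i)              ∎)
        where
        open ≈-Reasoning
        lemma : ∀ j m i t → j * m * (suc i * t) ≡ j * suc i * (m * t)
        lemma = ℕ-Solver.solve-∀
        -- x = (i + 1) t, so j m x is a multiple of m t = n, and a^(r x) = aˣ a^(j m x) reduces to
        -- aˣ.
        n∣jmx : n ∣ j * m * x i
        n∣jmx = divides (j * suc (toℕ i)) (trans (lemma j m (toℕ i) t) (cong (j * suc (toℕ i) *_) (sym n≡mt)))
      x∈matches : ∀ i → x i ∈ matches g₁ g₂ 0ℤ 0ℤ
      x∈matches i with x∈range i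
      ... | 0<x , x≤n = ∈-filter⁺ (match? g₁ g₂ 0ℤ 0ℤ) (∈-range⁺ 0<x x≤n)
        ( subst (λ z → (+ 1 ℤ.≤ z) × (z ℤ.≤ + n)) (sym (ℤ.+-identityʳ (+ x i))) (ℤ.+≤+ 0<x , ℤ.+≤+ x≤n)
        , trans (ℤ.+-identityʳ _) (cong +_ (trans (same-value i) (cong (welchPerm p g₂) (sym (ℕ.+-identityʳ (x i)))))))

    maxCrossCorrelation≡ : .{{_ : NonZero t}} → maxCrossCorrelationWelch p ≡ n / t
    maxCrossCorrelation≡ = trans (ℕ.≤-antisym upper lower) (sym (trans (cong (_/ t) n≡mt) (ℕ.m*n/n≡m m t)))

theorem1 : (p : ℕ) .{{_ : NonZero p}} → Prime p → 5 ≤ p →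
    (Prime ((p ∸ 1) / 2) →
    maxCrossCorrelationWelch p ≤ 1 + welchFloor p)
    × (¬ Prime ((p ∸ 1) / 2) →
    (t : ℕ) .{{_ : NonZero t}} → Prime t → t ∣ (p ∸ 1) / 2 →
    (∀ q → Prime q → q ∣ (p ∸ 1) / 2 → t ≤ q) →
    maxCrossCorrelationWelch p ≡ (p ∸ 1) / t)
theorem1 (suc n) p-prime (s≤s 4≤n) = safe-prime-bound , λ ¬h-prime t t-prime t∣h t-least →
  NonSafe.maxCrossCorrelation≡ t-prime (_∣_.equality t∣h) (t≤quotient 0<h ¬h-prime t-prime t∣h t-least) t-least
  where
  open WelchCorrelation n p-prime 4≤n
  0<h : 0 < n / 2
  0<h = ℕ.m≥n⇒m/n>0 (ℕ.≤-trans (s≤s (s≤s z≤n)) 4≤n)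
  -- Quotient 1 would make h = t prime. A larger quotient has a prime factor, which divides `h` and
  -- is therefore at least `t`.
  t≤quotient : ∀ {t h} → 0 < h → ¬ Prime h → Prime t → (t∣h : t ∣ h) → (∀ q → Prime q → q ∣ h → t ≤ q) →
    t ≤ ℕ.quotient t∣h
  t≤quotient {t} () ¬h-prime t-prime (divides 0 refl) t-least
  t≤quotient {t} _ ¬h-prime t-prime (divides 1 refl) t-least =
    contradiction (subst Prime (sym (ℕ.*-identityˡ t)) t-prime) ¬h-prime
  t≤quotient {t} _ ¬h-prime t-prime (divides s@(suc (suc _)) refl) t-least with prime-divisor s (s≤s z<s)
  ... | q , q-prime , q∣s = ℕ.≤-trans (t-least q q-prime (ℕ.∣m⇒∣m*n t q∣s)) (ℕ.∣⇒≤ q∣s)
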